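{- Let $n\ge1$. For $v,w\in\mathfrak{S}_n$ set $$\lambda(v,w)=\#\{J\subseteq[n-1]:\mathrm{Des}(w^{ -1}v_J)\subseteq J,\ \#J\text{ odd}\}-\#\{J\subseteq[n-1]:\mathrm{Des}(w^{ -1}v_J)\subseteq J,\ \#J\text{ even}\}.$$ Then the antipode $S$ of $\mathfrak{S}Sym$ satisfies $S(\mathcal{F}_v)=\sum_{w\in\mathfrak{S}_n}\lambda(v,w)\,\mathcal{F}_w$.
   Context: Permutations in one-line notation, product is composition $(uv)(i)=u(v(i))$. $\mathrm{Des}(x)=\{p\in[n-1]:x_p>x_{p+1}\}$. $\mathrm{st}(a_1,\ldots,a_m)\in\mathfrak{S}_m$ is the permutation with the same relative order as the distinct integers $a_i$. For $x\in\mathfrak{S}_a,y\in\mathfrak{S}_b$, $x\times y\in\mathfrak{S}_{a+b}$ has $(x\times y)(i)=x_i$ ($i\le a$), $(x\times y)(a+j)=a+y_j$. For $v\in\mathfrak{S}_n$ and $J=\{p_1<\cdots<p_k\}\subseteq[n-1]$, $v_J=\mathrm{st}(v_1,\ldots,v_{p_1})\times\mathrm{st}(v_{p_1+1},\ldots,v_{p_2})\times\cdots\times\mathrm{st}(v_{p_k+1},\ldots,v_n)$, $v_\emptyset=v$. $\mathfrak{S}Sym$ is the graded connected Hopf algebra over $\mathbb{Q}$ with basis $\{\mathcal{F}_u:u\in\mathfrak{S}_n,n\ge0\}$, product $\mathcal{F}_u\cdot\mathcal{F}_v=\sum_{\zeta}\mathcal{F}_{(u\times v)\cdot\zeta^{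 -1}}$ over $\zeta\in\mathfrak{S}_{p+q}$ with $\zeta_1<\cdots<\zeta_p$, $\zeta_{p+1}<\cdots<\zeta_{p+q}$ (for $u\in\mathfrak{S}_p,v\in\mathfrak{S}_q$), and coproduct $\Delta(\mathcal{F}_u)=\sum_{p=0}^n\mathcal{F}_{\mathrm{st}(u_1..u_p)}\otimes\mathcal{F}_{\mathrm{st}(u_{p+1}..u_n)}$. -}

module Defs where

open import Algebra.Module.Bundles using (Module)
open import Algebra.Module.Morphism.Structures using (IsModuleHomomorphism)
open import Algebra.Module.Structures.Biased using (IsModuleFromLeft)
open import Data.Bool.Base using (T; true; false; if_then_else_)
open import Data.Fin.Base as Fin using (Fin; zero; suc; toℕ; fromℕ<; inject₁; cast; punchIn; _↑ˡ_; _↑ʳ_)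
open import Data.Fin.Permutation as Perm using (Permutation′; _⟨$⟩ʳ_; _∘ₚ_; flip; insert; remove)
import Data.Fin.Properties as Fin
open import Data.Fin.Subset using (Subset; inside; outside; ∣_∣; _∈_)
open import Data.Fin.Subset.Properties using (_⊆?_; ∣p∣≤n; p⊆q⇒∣p∣≤∣q∣; p⊂q⇒∣p∣<∣q∣)
open import Data.Integer.Base as ℤ using (ℤ; +_)
open import Data.List.Base using (List; []; _∷_; [_]; _++_; map; concatMap; filter; length; allFin; cartesianProductWith)
open import Data.List.Membership.Propositional.Properties using (∈-allFin)
open import Data.List.Relation.Unary.Any using (Any; here)
import Data.List.Relation.Unary.Any.Properties as Any
open import Data.List.Relation.Unary.All using (All)
import Data.List.Relation.Unary.All as All
import Data.List.Relation.Unary.All.Properties as All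
open import Data.List.Relation.Unary.AllPairs using (AllPairs; []; _∷_)
import Data.List.Relation.Unary.AllPairs as AllPairs
import Data.List.Relation.Unary.AllPairs.Properties as AllPairs
open import Data.List.Relation.Unary.Unique.Propositional using (Unique)
import Data.List.Relation.Unary.Unique.Propositional.Properties as Unique
open import Data.Nat.Base using (ℕ; zero; suc; _+_; _∸_; _≤_; _<_; s≤s)
import Data.Nat.Properties as ℕ
open import Data.Nat.ListAction using (sum)
open import Data.Nat.Divisibility using (_∣_; _∣?_)
open import Data.Product.Base using (_×_; _,_; Σ-syntax)
open import Data.Rational.Base as ℚ using (ℚ; 0ℚ; 1ℚ)
import Data.Rational.Properties as ℚ
open import Data.Sum.Function.Propositional using (_⊎-↔_)
open import Data.Vec.Base using ([]; _∷_; tabulate)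
open import Data.Vec.Properties using (lookup∘tabulate; lookup⇒[]=; []=⇒lookup)
open import Function.Base using (_∘_; id)
open import Function.Bundles using (_⇔_; mk⇔)
open import Function.Construct.Composition using (_↔-∘_)
open import Function.Construct.Symmetry using (↔-sym)
open import Function.Definitions using (Injective)
open import Level using (0ℓ)
open import Relation.Binary.Bundles using (DecSetoid)
open import Relation.Binary.Core using (Rel)
open import Relation.Binary.Definitions using (Decidable; tri<; tri≈; tri>)
open import Relation.Binary.PropositionalEquality using (_≡_; _≢_; refl; sym; trans; cong; cong₂; subst; subst₂)
open import Relation.Nullary using (¬_; Dec; yes; no; does; contradiction)
open import Relation.Nullary.Decidable using (¬?; _×-dec_; _→-dec_; dec-true; dec-false)

private
  variable
    m n p q : ℕ
    A B C D I : Set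

------------------------------------------------------------------------
-- Permutations.  Positions and values are 0-based: Fin n stands for [n].

infixl 7 _·_
infixr 6 _×ₚ_

_·_ : Permutation′ n → Permutation′ n → Permutation′ n
u · v = v ∘ₚ u

_×ₚ_ : Permutation′ p → Permutation′ q → Permutation′ (p + q)
x ×ₚ y = ↔-sym Fin.+↔⊎ ↔-∘ ((x ⊎-↔ y) ↔-∘ Fin.+↔⊎)

oneLine : Permutation′ n → Fin n → ℕ
oneLine v i = toℕ (v ⟨$⟩ʳ i)

-- {j : a_j < b}
below : ℕ → (Fin m → ℕ) → Subset m
below b a = tabulate λ j → does (a j ℕ.<? b)

-- Only meaningful for sequences with distinct entries, where it is
-- characterised by st-order.
st : (Fin m → ℕ) → Permutation′ m
st {zero}  a = Perm.id
st {suc m} a = insert zero (fromℕ< (s≤s (∣p∣≤n (below (a zero) (a ∘ suc))))) (st (a ∘ suc))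

module _ {a : Fin m → ℕ} {b : ℕ} {j : Fin m} where

  ∈-below⁺ : a j < b → j ∈ below b a
  ∈-below⁺ lt = lookup⇒[]= j _ (trans (lookup∘tabulate _ j) (dec-true (a j ℕ.<? b) lt))

  ∈-below⁻ : j ∈ below b a → a j < b
  ∈-below⁻ j∈ = ℕ.<ᵇ⇒< (a j) b (subst T (trans (sym ([]=⇒lookup j∈)) (lookup∘tabulate _ j)) _)

below-≤ : ∀ (a : Fin m → ℕ) {b c} → b ≤ c → ∣ below b a ∣ ≤ ∣ below c a ∣
below-≤ a b≤c = p⊆q⇒∣p∣≤∣q∣ λ j∈ → ∈-below⁺ {a = a} (ℕ.<-≤-trans (∈-below⁻ {a = a} j∈) b≤c)

below-< : ∀ (a : Fin m → ℕ) j {c} → a j < c → ∣ below (a j) a ∣ < ∣ below c a ∣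
below-< a j aj<c = p⊂q⇒∣p∣<∣q∣
  ( (λ k∈ → ∈-below⁺ {a = a} (ℕ.<-trans (∈-below⁻ {a = a} k∈) aj<c))
  , j , ∈-below⁺ {a = a} aj<c , λ j∈ → ℕ.<-irrefl refl (∈-below⁻ {a = a} j∈))

toℕ-punchIn-≤ : ∀ (i : Fin (suc m)) j → toℕ i ≤ toℕ j → toℕ (punchIn i j) ≡ suc (toℕ j)
toℕ-punchIn-≤ zero    j       _       = refl
toℕ-punchIn-≤ (suc i) (suc j) (s≤s p) = cong suc (toℕ-punchIn-≤ i j p)

toℕ-punchIn-> : ∀ (i : Fin (suc m)) j → toℕ j < toℕ i → toℕ (punchIn i j) ≡ toℕ j
toℕ-punchIn-> (suc i) zero    _       = refl
toℕ-punchIn-> (suc i) (suc j) (s≤s p) = cong suc (toℕ-punchIn-> i j p)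

st-rank : (a : Fin m → ℕ) → Injective _≡_ _≡_ a → ∀ i → oneLine (st a) i ≡ ∣ below (a i) a ∣
st-rank {suc m} a inj zero rewrite dec-false (a zero ℕ.<? a zero) (ℕ.<-irrefl refl) = Fin.toℕ-fromℕ< _
st-rank {suc m} a inj (suc i) with st-rank (a ∘ suc) (Fin.suc-injective ∘ inj) i | ℕ.<-cmp (a zero) (a (suc i))
... | ih | tri< lt _ _ rewrite dec-true (a zero ℕ.<? a (suc i)) lt =
  trans (toℕ-punchIn-≤ _ (st (a ∘ suc) ⟨$⟩ʳ i)
          (subst₂ _≤_ (sym (Fin.toℕ-fromℕ< _)) (sym ih) (below-≤ (a ∘ suc) (ℕ.<⇒≤ lt))))
        (cong suc ih)
... | ih | tri≈ _ eq _ = contradiction (inj eq) λ ()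
... | ih | tri> nlt _ gt rewrite dec-false (a zero ℕ.<? a (suc i)) nlt =
  trans (toℕ-punchIn-> _ (st (a ∘ suc) ⟨$⟩ʳ i)
          (subst₂ _<_ (sym ih) (sym (Fin.toℕ-fromℕ< _)) (below-< (a ∘ suc) i gt)))
        ih

st-order : (a : Fin m → ℕ) → Injective _≡_ _≡_ a →
           ∀ i j → a i < a j ⇔ oneLine (st a) i < oneLine (st a) j
st-order a inj i j rewrite st-rank a inj i | st-rank a inj j =
  mk⇔ (below-< a i) λ lt → ℕ.≰⇒> λ aj≤ai → ℕ.<⇒≱ lt (below-≤ a aj≤ai)

-- Each element of 𝔖ₙ exactly once, see permutations-complete and
-- permutations-unique.
permutations : ∀ n → List (Permutation′ n)
permutations zero    = [ Perm.id ]
permutations (suc n) = cartesianProductWith (insert zero) (allFin (suc n)) (permutations n)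

permutations-complete : (u : Permutation′ n) → Any (Perm._≈ u) (permutations n)
permutations-complete {zero}  u = here λ ()
permutations-complete {suc n} u = Any.cartesianProductWith⁺ (insert zero) ins
  (∈-allFin (u ⟨$⟩ʳ zero)) (permutations-complete (remove zero u))
  where
  ins : ∀ {j π} → u ⟨$⟩ʳ zero ≡ j → π Perm.≈ remove zero u → insert zero j π Perm.≈ u
  ins refl π≈ zero    = refl
  ins refl π≈ (suc i) = trans (cong (punchIn (u ⟨$⟩ʳ zero)) (π≈ i)) (Perm.insert-remove zero u (suc i))

permutations-unique : ∀ n → AllPairs (λ u v → ¬ u Perm.≈ v) (permutations n)
permutations-unique zero    = All.[] ∷ []
permutations-unique (suc n) = go (Unique.allFin⁺ (suc n))
  where
  row : Fin (suc n) → List (Permutation′ (suc n))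
  row j = map (insert zero j) (permutations n)

  row-≉ : ∀ {j k} → j ≢ k → All (λ u → All (λ v → ¬ u Perm.≈ v) (row k)) (row j)
  row-≉ j≢k = All.map⁺ (All.universal (λ _ → All.map⁺ (All.universal (λ _ u≈v → j≢k (u≈v zero)) _)) _)

  rest-≉ : ∀ {j ks} → All (j ≢_) ks →
           All (λ u → All (λ v → ¬ u Perm.≈ v) (cartesianProductWith (insert zero) ks (permutations n))) (row j)
  rest-≉ All.[]        = All.universal (λ _ → All.[]) _
  rest-≉ (p All.∷ ps) = All.zipWith (λ (x , y) → All.++⁺ x y) (row-≉ p , rest-≉ ps)

  go : ∀ {js} → Unique js → AllPairs (λ u v → ¬ u Perm.≈ v) (cartesianProductWith (insert zero) js (permutations n))
  go []           = []
  go (j≢ ∷ uniq) = AllPairs.++⁺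
    (AllPairs.map⁺ (AllPairs.map (λ u≉v u≈v → u≉v λ i → Fin.punchIn-injective _ _ _ (u≈v (suc i))) (permutations-unique n)))
    (go uniq) (rest-≉ j≢)

------------------------------------------------------------------------
-- Subsets J of [n-1], for n = suc m.  The index i : Fin m stands for
-- the element toℕ i + 1 of [n-1].

Des : Permutation′ (suc m) → Subset m
Des x = tabulate λ i → does (x ⟨$⟩ʳ suc i Fin.<? x ⟨$⟩ʳ inject₁ i)

subsets : ∀ m → List (Subset m)
subsets zero    = [ [] ]
subsets (suc m) = map (outside ∷_) (subsets m) ++ map (inside ∷_) (subsets m)

-- For J = {p₁ < ⋯ < p_k}, gaps 1 J is p₁, p₂ - p₁, …, n - p_k.  The
-- first argument is the length so far of the current block.
gaps : ℕ → Subset m → List ℕ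
gaps c []            = c ∷ []
gaps c (inside  ∷ J) = c ∷ gaps 1 J
gaps c (outside ∷ J) = gaps (suc c) J

sum-gaps : ∀ c (J : Subset m) → sum (gaps c J) ≡ c + m
sum-gaps         c []            = refl
sum-gaps         c (inside  ∷ J) = cong (_+_ c) (sum-gaps 1 J)
sum-gaps {suc m} c (outside ∷ J) = trans (sum-gaps (suc c) J) (sym (ℕ.+-suc c m))

-- st of each of the consecutive blocks of lengths cs, combined by ×
stBlocks : (cs : List ℕ) → (Fin (sum cs) → ℕ) → Permutation′ (sum cs)
stBlocks []       a = Perm.id
stBlocks (c ∷ cs) a = st (a ∘ (_↑ˡ sum cs)) ×ₚ stBlocks cs (a ∘ (c ↑ʳ_))

infix 8 _↓_

-- v ↓ J is v_J
_↓_ : Permutation′ (suc m) → Subset m → Permutation′ (suc m)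
v ↓ J = subst Permutation′ eq (stBlocks (gaps 1 J) (oneLine v ∘ cast eq))
  where eq = sum-gaps 1 J

-- λ(v,w)
antipodeCoeff : Permutation′ (suc m) → Permutation′ (suc m) → ℤ
antipodeCoeff {m} v w = + count (¬? ∘ even?) ℤ.- + count even?
  where
  even? : (J : Subset m) → Dec (2 ∣ ∣ J ∣)
  even? J = 2 ∣? ∣ J ∣

  count : {P : Subset m → Set} → (∀ J → Dec (P J)) → ℕ
  count P? = length (filter (λ J → (Des (flip w · v ↓ J) ⊆? J) ×-dec P? J) (subsets m))

------------------------------------------------------------------------
-- The free ℚ-vector space on a set with decidable equality.  An element
-- is a formal linear combination; two are equal when all coefficients
-- agree.

Free : Set → Set
Free A = List (ℚ × A)

infixl 6 _⊕_
infixr 7 _•_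

_⊕_ : Free A → Free A → Free A
_⊕_ = _++_

_•_ : ℚ → Free A → Free A
c • x = map (λ (q , a) → c ℚ.* q , a) x

basis : A → Free A
basis a = [ 1ℚ , a ]

∑ : List I → (I → Free A) → Free A
∑ is f = concatMap f is

-- The linear extension of a map defined on the basis
extend : (A → Free B) → Free A → Free B
extend f x = ∑ x λ (q , a) → q • f a

-- Free (A × B) serves as Free A ⊗ Free B; x ⊠ y is the pure tensor.
infixr 8 _⊠_ _⊗_

_⊠_ : Free A → Free B → Free (A × B)
_⊠_ = cartesianProductWith λ (p , a) (q , b) → p ℚ.* q , a , b

_⊗_ : (Free A → Free C) → (Free B → Free D) → Free (A × B) → Free (C × D)
f ⊗ g = extend λ (a , b) → f (basis a) ⊠ g (basis b)

module _ (X : DecSetoid 0ℓ 0ℓ) where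
  open DecSetoid X using (Carrier; _≟_)

  coeff : Free Carrier → Carrier → ℚ
  coeff []            b = 0ℚ
  coeff ((q , a) ∷ x) b = (if does (a ≟ b) then q else 0ℚ) ℚ.+ coeff x b

  private
    coeff-⊕ : ∀ x y b → coeff (x ⊕ y) b ≡ coeff x b ℚ.+ coeff y b
    coeff-⊕ []            y b = sym (ℚ.+-identityˡ _)
    coeff-⊕ ((q , a) ∷ x) y b =
      trans (cong (ℚ._+_ c) (coeff-⊕ x y b)) (sym (ℚ.+-assoc c (coeff x b) (coeff y b)))
      where c = if does (a ≟ b) then q else 0ℚ

    coeff-• : ∀ c x b → coeff (c • x) b ≡ c ℚ.* coeff x b
    coeff-• c []            b = sym (ℚ.*-zeroʳ c)
    coeff-• c ((q , a) ∷ x) b with does (a ≟ b)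
    ... | true  = trans (cong (ℚ._+_ (c ℚ.* q)) (coeff-• c x b)) (sym (ℚ.*-distribˡ-+ c q (coeff x b)))
    ... | false = trans (cong₂ ℚ._+_ (sym (ℚ.*-zeroʳ c)) (coeff-• c x b)) (sym (ℚ.*-distribˡ-+ c 0ℚ (coeff x b)))

    _≈_ : Rel (Free Carrier) 0ℓ
    x ≈ y = ∀ b → coeff x b ≡ coeff y b

    -1• : Free Carrier → Free Carrier
    -1• x = (ℚ.- 1ℚ) • x

    coeff-neg : ∀ x b → coeff (-1• x) b ≡ ℚ.- coeff x b
    coeff-neg x b = trans (coeff-• (ℚ.- 1ℚ) x b)
      (trans (sym (ℚ.neg-distribˡ-* 1ℚ (coeff x b))) (cong ℚ.-_ (ℚ.*-identityˡ (coeff x b))))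

    ⊕-cong : ∀ {x y u v} → x ≈ y → u ≈ v → (x ⊕ u) ≈ (y ⊕ v)
    ⊕-cong {x} {y} {u} {v} x≈y u≈v b =
      trans (coeff-⊕ x u b) (trans (cong₂ ℚ._+_ (x≈y b) (u≈v b)) (sym (coeff-⊕ y v b)))

    ⊕-comm : ∀ x y → (x ⊕ y) ≈ (y ⊕ x)
    ⊕-comm x y b = trans (coeff-⊕ x y b) (trans (ℚ.+-comm (coeff x b) (coeff y b)) (sym (coeff-⊕ y x b)))

    ⊕-assoc : ∀ x y z → ((x ⊕ y) ⊕ z) ≈ (x ⊕ (y ⊕ z))
    ⊕-assoc x y z b rewrite coeff-⊕ (x ⊕ y) z b | coeff-⊕ x y b | coeff-⊕ x (y ⊕ z) b | coeff-⊕ y z b =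
      ℚ.+-assoc (coeff x b) (coeff y b) (coeff z b)

    •-cong : ∀ {c d x y} → c ≡ d → x ≈ y → (c • x) ≈ (d • y)
    •-cong {c} {d} {x} {y} refl x≈y b =
      trans (coeff-• c x b) (trans (cong (ℚ._*_ c) (x≈y b)) (sym (coeff-• c y b)))

    inverseˡ : ∀ x → (-1• x ⊕ x) ≈ []
    inverseˡ x b = trans (coeff-⊕ (-1• x) x b)
      (trans (cong (λ q → q ℚ.+ coeff x b) (coeff-neg x b)) (ℚ.+-inverseˡ (coeff x b)))

  freeModule : Module ℚ.+-*-commutativeRing 0ℓ 0ℓ
  freeModule = record
    { Carrierᴹ = Free Carrier
    ; _≈ᴹ_     = _≈_
    ; _+ᴹ_     = _⊕_
    ; _*ₗ_     = _•_
    ; _*ᵣ_     = λ x c → c • x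
    ; 0ᴹ       = []
    ; -ᴹ_      = -1•
    ; isModule = IsModuleFromLeft.isModule {commutativeRing = ℚ.+-*-commutativeRing} (record
      { isLeftModule = record
        { isLeftSemimodule = record
          { +ᴹ-isCommutativeMonoid = record
            { isMonoid = record
              { isSemigroup = record
                { isMagma = record
                  { isEquivalence = record
                    { refl  = λ _ → refl
                    ; sym   = λ x≈y b → sym (x≈y b)
                    ; trans = λ x≈y y≈z b → trans (x≈y b) (y≈z b)
                    }
                  ; ∙-cong = λ {x} {y} {u} {v} → ⊕-cong {x} {y} {u} {v}
                  }
                ; assoc = ⊕-assoc
                }
              ; identity = (λ _ _ → refl) , (λ x b → trans (coeff-⊕ x [] b) (ℚ.+-identityʳ (coeff x b)))
              }
            ; comm = ⊕-comm
            }
          ; isPreleftSemimodule = record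
            { *ₗ-cong      = λ {c} {d} {x} {y} → •-cong {c} {d} {x} {y}
            ; *ₗ-zeroˡ     = λ x b → trans (coeff-• 0ℚ x b) (ℚ.*-zeroˡ (coeff x b))
            ; *ₗ-distribʳ  = λ x c d b → trans (coeff-• (c ℚ.+ d) x b)
                (trans (ℚ.*-distribʳ-+ (coeff x b) c d)
                (trans (cong₂ ℚ._+_ (sym (coeff-• c x b)) (sym (coeff-• d x b)))
                       (sym (coeff-⊕ (c • x) (d • x) b))))
            ; *ₗ-identityˡ = λ x b → trans (coeff-• 1ℚ x b) (ℚ.*-identityˡ (coeff x b))
            ; *ₗ-assoc     = λ c d x b → trans (coeff-• (c ℚ.* d) x b)
                (trans (ℚ.*-assoc c d (coeff x b))
                (trans (cong (ℚ._*_ c) (sym (coeff-• d x b))) (sym (coeff-• c (d • x) b))))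
            ; *ₗ-zeroʳ     = λ _ _ → refl
            ; *ₗ-distribˡ  = λ c x y b → trans (coeff-• c (x ⊕ y) b)
                (trans (cong (ℚ._*_ c) (coeff-⊕ x y b))
                (trans (ℚ.*-distribˡ-+ c (coeff x b) (coeff y b))
                (trans (cong₂ ℚ._+_ (sym (coeff-• c x b)) (sym (coeff-• c y b)))
                       (sym (coeff-⊕ (c • x) (c • y) b)))))
            }
          }
        ; -ᴹ‿cong    = λ {x} {y} → •-cong {ℚ.- 1ℚ} {ℚ.- 1ℚ} {x} {y} refl
        ; -ᴹ‿inverse = inverseˡ , λ x b → trans (⊕-comm x (-1• x) b) (inverseˡ x b)
        }
      })
    }

------------------------------------------------------------------------
-- 𝔖Sym

𝔖 : Set
𝔖 = Σ[ n ∈ ℕ ] Permutation′ n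

data _≈𝔖_ : Rel 𝔖 0ℓ where
  same : {u v : Permutation′ n} → u Perm.≈ v → (n , u) ≈𝔖 (n , v)

_≟𝔖_ : Decidable _≈𝔖_
(m , u) ≟𝔖 (n , v) with m ℕ.≟ n
... | no m≢n = no λ { (same _) → m≢n refl }
... | yes refl with Fin.all? (λ i → u ⟨$⟩ʳ i Fin.≟ v ⟨$⟩ʳ i)
...   | yes u≈v = yes (same u≈v)
...   | no  u≉v = no λ { (same u≈v) → u≉v u≈v }

𝔖-decSetoid : DecSetoid 0ℓ 0ℓ
𝔖-decSetoid = record
  { Carrier = 𝔖
  ; _≈_     = _≈𝔖_
  ; isDecEquivalence = record
    { isEquivalence = record
      { refl  = same λ _ → refl
      ; sym   = λ { (same u≈v) → same (sym ∘ u≈v) }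
      ; trans = λ { (same u≈v) (same v≈w) → same λ i → trans (u≈v i) (v≈w i) }
      }
    ; _≟_ = _≟𝔖_
    }
  }

𝔖Sym-module : Module ℚ.+-*-commutativeRing 0ℓ 0ℓ
𝔖Sym-module = freeModule 𝔖-decSetoid

open Module 𝔖Sym-module public using (rawModule) renaming (Carrierᴹ to 𝔖Sym; _≈ᴹ_ to infix 4 _≈_)

ℱ : Permutation′ n → 𝔖Sym
ℱ {n} u = basis (n , u)

-- ζ₁ < ⋯ < ζ_p and ζ_{p+1} < ⋯ < ζ_{p+q}
IsShuffle : ∀ p q → Permutation′ (p + q) → Set
IsShuffle p q ζ =
  (∀ (i j : Fin p) → i Fin.< j → ζ ⟨$⟩ʳ (i ↑ˡ q) Fin.< ζ ⟨$⟩ʳ (j ↑ˡ q)) ×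
  (∀ (i j : Fin q) → i Fin.< j → ζ ⟨$⟩ʳ (p ↑ʳ i) Fin.< ζ ⟨$⟩ʳ (p ↑ʳ j))

isShuffle? : ∀ p q (ζ : Permutation′ (p + q)) → Dec (IsShuffle p q ζ)
isShuffle? p q ζ =
  Fin.all? (λ i → Fin.all? λ j → (i Fin.<? j) →-dec (_ Fin.<? _)) ×-dec
  Fin.all? (λ i → Fin.all? λ j → (i Fin.<? j) →-dec (_ Fin.<? _))

product : 𝔖 × 𝔖 → 𝔖Sym
product ((p , u) , (q , v)) =
  ∑ (filter (isShuffle? p q) (permutations (p + q))) λ ζ → ℱ ((u ×ₚ v) · flip ζ)

coproduct : 𝔖 → Free (𝔖 × 𝔖)
coproduct (n , u) = ∑ (allFin (suc n)) λ i →
  let p = toℕ i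
      a = oneLine u ∘ cast (ℕ.m+[n∸m]≡n {p} {n} (Fin.toℕ≤pred[n] i))
  in  ℱ (st (a ∘ (_↑ˡ (n ∸ p)))) ⊠ ℱ (st (a ∘ (p ↑ʳ_)))

μ : Free (𝔖 × 𝔖) → 𝔖Sym
μ = extend product

Δ : 𝔖Sym → Free (𝔖 × 𝔖)
Δ = extend coproduct

-- 𝔖Sym is graded and connected, so unit and counit are the inclusion of
-- and the projection to degree 0, which is spanned by ℱ of the empty
-- permutation.

η : ℚ → 𝔖Sym
η c = c • ℱ {0} Perm.id

ε : 𝔖Sym → ℚ
ε x = coeff 𝔖-decSetoid x (0 , Perm.id)

record IsAntipode (S : 𝔖Sym → 𝔖Sym) : Set where
  field
    isLinear : IsModuleHomomorphism rawModule rawModule S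
    inverseˡ : ∀ x → μ ((S ⊗ id) (Δ x)) ≈ η (ε x)
    inverseʳ : ∀ x → μ ((id ⊗ S) (Δ x)) ≈ η (ε x)

{-# OPTIONS --safe #-}
module Submission where

-- Peeling the first block off the convolution identity id ⋆ S = η ε expands
-- S(ℱ_v), recursively, into the signed sum over J ⊆ [n-1] of the products
-- ℱ_{st(v₁…v_{p₁})} ⋯ ℱ_{st(v_{p_k+1}…v_n)}.  Such a product is the sum of
-- the ℱ_w for which ζ = w⁻¹ v_J increases on each block of J, that is
-- Des ζ ⊆ J.  For this, multiplication by one more factor ℱ_x on the left is
-- described coefficientwise: given w, a shuffle w⁻¹ (x × w′) exists for exactly
-- one w′, namely the permutation sorting the values of w⁻¹ on the second block.

open import Defs
open import Algebra.Bundles using (module CommutativeMonoid)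
open import Algebra.Module.Morphism.Structures using (module IsModuleHomomorphism)
open import Data.Bool.Base using (true; false; if_then_else_)
open import Data.Fin.Base as Fin using (Fin; zero; suc; toℕ; fromℕ<; inject₁; cast; punchIn; splitAt; join; _↑ˡ_; _↑ʳ_)
open import Data.Fin.Permutation as Perm using (Permutation′; _⟨$⟩ʳ_; _⟨$⟩ˡ_; flip)
import Data.Fin.Properties as Fin
open import Data.Fin.Subset using (Subset; inside; outside; ∣_∣; _∈_; _∉_; _⊆_)
open import Data.Fin.Subset.Properties using (_⊆?_; _∈?_; drop-there)
open import Data.Integer.Base as ℤ using () renaming (+_ to pos)
import Data.Integer.Properties as ℤ
open import Data.List.Base using (List; []; _∷_; _++_; map; concatMap; filter; length; allFin)
open import Data.List.Properties using (length-filter; map-tabulate)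
open import Data.List.Relation.Unary.All as All using (All; []; _∷_)
open import Data.List.Relation.Unary.AllPairs using (AllPairs; []; _∷_)
open import Data.List.Relation.Unary.Any as Any using (Any; here; there)
open import Data.Nat.Base using (ℕ; zero; suc; _+_; _∸_; _≤_; _<_; z≤n; s≤s)
open import Data.Nat.Divisibility using (_∣?_; ∣m+n∣m⇒∣n; ∣m∣n⇒∣m+n; ∣-refl)
open import Data.Nat.Induction using (<-rec)
open import Data.Nat.ListAction using (sum)
import Data.Nat.Properties as ℕ
open import Data.Product.Base using (_×_; _,_; proj₁; proj₂; ∃)
open import Data.Rational.Base as ℚ using (ℚ; 0ℚ; 1ℚ; _/_; toℚᵘ)
import Data.Rational.Properties as ℚ
import Data.Rational.Unnormalised.Base as ℚᵘ
import Data.Rational.Unnormalised.Properties as ℚᵘ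
open import Data.Sum.Base as Sum using (inj₁; inj₂)
open import Data.Unit.Base using (⊤; tt)
open import Data.Vec.Base using ([]; _∷_; here; there)
import Data.Vec.Properties as Vec
open import Function.Base using (_∘_; id)
open import Function.Bundles using (_⇔_; mk⇔; module Equivalence)
open import Function.Definitions using (Injective)
open import Level using (0ℓ)
open import Relation.Binary.Bundles using (DecSetoid)
open import Relation.Binary.PropositionalEquality using (_≡_; _≢_; refl; sym; trans; cong; cong₂; subst; subst₂; module ≡-Reasoning)
open import Relation.Nullary using (¬_; Dec; yes; no; does; contradiction)
open import Relation.Nullary.Decidable using (¬?; _×-dec_; _→-dec_; does-⇔; dec-true; dec-false)

open import Algebra.Properties.CommutativeSemigroup (CommutativeMonoid.commutativeSemigroup ℚ.+-0-commutativeMonoid) using (interchange)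
open import Algebra.Properties.Group ℚ.+-0-group using (⁻¹-involutive; inverseˡ-unique; x∙y⁻¹≈ε⇒x≈y)

-- Elements of `𝔖Sym` are formal lists and `_≈_` compares coefficients only, so a value of `S` is
-- determined only up to `_≈_`. Every identity is therefore tested at one basis element, through
-- linear functionals `lin`, and `lin-cong` is what allows a formula for `S` to be substituted
-- inside a product. In the convolution identity the summand with empty left factor is S(ℱ_v)
-- itself, and every other summand involves S of a proper suffix; hence strong induction on the
-- length. A suffix of v is in general not a permutation, so the induction ranges over standardized
-- prefixes of arbitrary injective sequences. Each peeled block contributes a factor -1 and J cuts v
-- into #J + 1 blocks. This gives the sign (-1)^(#J+1) and explains why odd J count positively in λ.

private
  variable
    m n p q : ℕ
    A B I : Set
    P Q : Set

-- Finite sums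

sumOver : List A → (A → ℚ) → ℚ
sumOver []       f = 0ℚ
sumOver (x ∷ xs) f = f x ℚ.+ sumOver xs f

sumOver-cong : ∀ {f g : A → ℚ} → (∀ x → f x ≡ g x) → ∀ xs → sumOver xs f ≡ sumOver xs g
sumOver-cong eq []       = refl
sumOver-cong eq (x ∷ xs) = cong₂ ℚ._+_ (eq x) (sumOver-cong eq xs)

sumOver-zero : ∀ {f : A → ℚ} {xs} → All (λ x → f x ≡ 0ℚ) xs → sumOver xs f ≡ 0ℚ
sumOver-zero []         = refl
sumOver-zero (eq ∷ eqs) = cong₂ ℚ._+_ eq (sumOver-zero eqs)

sumOver-++ : ∀ xs ys (f : A → ℚ) → sumOver (xs ++ ys) f ≡ sumOver xs f ℚ.+ sumOver ys f
sumOver-++ []       ys f = sym (ℚ.+-identityˡ _)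
sumOver-++ (x ∷ xs) ys f =
  trans (cong (f x ℚ.+_) (sumOver-++ xs ys f)) (sym (ℚ.+-assoc (f x) (sumOver xs f) (sumOver ys f)))

sumOver-map : ∀ (h : A → B) xs (f : B → ℚ) → sumOver (map h xs) f ≡ sumOver xs (f ∘ h)
sumOver-map h []       f = refl
sumOver-map h (x ∷ xs) f = cong (f (h x) ℚ.+_) (sumOver-map h xs f)

sumOver-concatMap : ∀ (h : A → List B) xs (f : B → ℚ) →
                    sumOver (concatMap h xs) f ≡ sumOver xs (λ x → sumOver (h x) f)
sumOver-concatMap h []       f = refl
sumOver-concatMap h (x ∷ xs) f =
  trans (sumOver-++ (h x) (concatMap h xs) f) (cong (sumOver (h x) f ℚ.+_) (sumOver-concatMap h xs f))

sumOver-* : ∀ c xs (f : A → ℚ) → sumOver xs (λ x → c ℚ.* f x) ≡ c ℚ.* sumOver xs f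
sumOver-* c []       f = sym (ℚ.*-zeroʳ c)
sumOver-* c (x ∷ xs) f =
  trans (cong (c ℚ.* f x ℚ.+_) (sumOver-* c xs f)) (sym (ℚ.*-distribˡ-+ c (f x) (sumOver xs f)))

sumOver-neg : ∀ xs (f : A → ℚ) → sumOver xs (λ x → ℚ.- f x) ≡ ℚ.- sumOver xs f
sumOver-neg []       f = refl
sumOver-neg (x ∷ xs) f =
  trans (cong (ℚ.- f x ℚ.+_) (sumOver-neg xs f)) (sym (ℚ.neg-distrib-+ (f x) (sumOver xs f)))

sumOver-+ : ∀ xs (f g : A → ℚ) → sumOver xs (λ x → f x ℚ.+ g x) ≡ sumOver xs f ℚ.+ sumOver xs g
sumOver-+ []       f g = refl
sumOver-+ (x ∷ xs) f g = trans (cong (f x ℚ.+ g x ℚ.+_) (sumOver-+ xs f g))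
                               (interchange (f x) (g x) (sumOver xs f) (sumOver xs g))

-- Iverson brackets

ind : Dec P → ℚ
ind P? = if does P? then 1ℚ else 0ℚ

ind-⇔ : P ⇔ Q → (P? : Dec P) (Q? : Dec Q) → ind P? ≡ ind Q?
ind-⇔ P⇔Q P? Q? = cong (if_then 1ℚ else 0ℚ) (does-⇔ P⇔Q P? Q?)

ind-true : (P? : Dec P) → P → ind P? ≡ 1ℚ
ind-true P? p = cong (if_then 1ℚ else 0ℚ) (dec-true P? p)

ind-false : (P? : Dec P) → ¬ P → ind P? ≡ 0ℚ
ind-false P? ¬p = cong (if_then 1ℚ else 0ℚ) (dec-false P? ¬p)

ind-× : (P? : Dec P) (Q? : Dec Q) → ind P? ℚ.* ind Q? ≡ ind (P? ×-dec Q?)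
ind-× P? Q? with does P?
... | true  = ℚ.*-identityˡ (ind Q?)
... | false = ℚ.*-zeroˡ (ind Q?)

sumOver-filter : ∀ {P : A → Set} (P? : ∀ x → Dec (P x)) xs (f : A → ℚ) →
                 sumOver (filter P? xs) f ≡ sumOver xs (λ x → ind (P? x) ℚ.* f x)
sumOver-filter P? []       f = refl
sumOver-filter P? (x ∷ xs) f with does (P? x)
... | true  = cong₂ ℚ._+_ (sym (ℚ.*-identityˡ (f x))) (sumOver-filter P? xs f)
... | false = trans (sumOver-filter P? xs f)
  (trans (sym (ℚ.+-identityˡ _)) (cong (ℚ._+ sumOver xs (λ y → ind (P? y) ℚ.* f y)) (sym (ℚ.*-zeroˡ (f x)))))

sumOver-ind-unique : ∀ {_~_ : A → A → Set} {P : A → Set} (P? : ∀ x → Dec (P x)) →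
                     (∀ {x y} → P x → P y → x ~ y) →
                     ∀ {xs} → AllPairs (λ x y → ¬ x ~ y) xs → Any P xs → sumOver xs (ind ∘ P?) ≡ 1ℚ
sumOver-ind-unique P? uniq {x ∷ _} (x≁ ∷ _) (here px) =
  cong₂ ℚ._+_ (ind-true (P? x) px)
    (sumOver-zero (All.map (λ {y} x≁y → ind-false (P? y) (x≁y ∘ uniq px)) x≁))
sumOver-ind-unique {A} {_~_} {P} P? uniq {x ∷ _} (x≁ ∷ ap) (there pxs) =
  cong₂ ℚ._+_ (ind-false (P? x) (λ px → ¬P px x≁ pxs)) (sumOver-ind-unique P? uniq ap pxs)
  where
  ¬P : P x → ∀ {ys} → All (λ y → ¬ x ~ y) ys → ¬ Any P ys
  ¬P px (x≁y ∷ _)  (here py)   = x≁y (uniq px py)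
  ¬P px (_ ∷ x≁ys) (there pys) = ¬P px x≁ys pys

-- Linear functionals on free modules

lin : (A → ℚ) → Free A → ℚ
lin g x = sumOver x λ (q , a) → q ℚ.* g a

lin-⊕ : ∀ (g : A → ℚ) x y → lin g (x ⊕ y) ≡ lin g x ℚ.+ lin g y
lin-⊕ g x y = sumOver-++ x y _

lin-ext : ∀ {g h : A → ℚ} → (∀ a → g a ≡ h a) → ∀ x → lin g x ≡ lin h x
lin-ext eq = sumOver-cong λ (q , a) → cong (q ℚ.*_) (eq a)

lin-basis : ∀ (g : A → ℚ) a → lin g (basis a) ≡ g a
lin-basis g a = trans (ℚ.+-identityʳ _) (ℚ.*-identityˡ (g a))

lin-• : ∀ (g : A → ℚ) c x → lin g (c • x) ≡ c ℚ.* lin g x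
lin-• g c x = trans (sumOver-map _ x _)
  (trans (sumOver-cong (λ (q , a) → ℚ.*-assoc c q (g a)) x) (sumOver-* c x _))

lin-∑ : ∀ (g : A → ℚ) (is : List I) f → lin g (∑ is f) ≡ sumOver is (lin g ∘ f)
lin-∑ g is f = sumOver-concatMap f is _

lin-extend : ∀ (g : B → ℚ) (f : A → Free B) x → lin g (extend f x) ≡ lin (λ a → lin g (f a)) x
lin-extend g f x = trans (lin-∑ g x _) (sumOver-cong (λ (q , a) → lin-• g q (f a)) x)

lin-basis-⊠ : ∀ (g : A × B → ℚ) a y → lin g (basis a ⊠ y) ≡ lin (λ b → g (a , b)) y
lin-basis-⊠ g a y = trans (lin-⊕ g (map _ y) [])
  (trans (ℚ.+-identityʳ _)
  (trans (sumOver-map _ y _) (sumOver-cong (λ (q , b) → cong (ℚ._* g (a , b)) (ℚ.*-identityˡ q)) y)))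

-- Functionals that depend only on the coefficients of a formal sum.

module _ (X : DecSetoid 0ℓ 0ℓ) where
  open DecSetoid X using (Carrier; _≟_) renaming (_≈_ to _~_; sym to ~-sym; trans to ~-trans; refl to ~-refl)

  coeff-lin : ∀ x b → coeff X x b ≡ lin (λ a → ind (a ≟ b)) x
  coeff-lin []            b = refl
  coeff-lin ((q , a) ∷ x) b = cong₂ ℚ._+_ (if-* (does (a ≟ b))) (coeff-lin x b)
    where
    if-* : ∀ t → (if t then q else 0ℚ) ≡ q ℚ.* (if t then 1ℚ else 0ℚ)
    if-* true  = sym (ℚ.*-identityʳ q)
    if-* false = sym (ℚ.*-zeroʳ q)

  coeff-resp : ∀ x {b c} → b ~ c → coeff X x b ≡ coeff X x c
  coeff-resp x {b} {c} b~c = trans (coeff-lin x b) (trans (lin-ext eq x) (sym (coeff-lin x c)))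
    where
    eq : ∀ a → ind (a ≟ b) ≡ ind (a ≟ c)
    eq a = ind-⇔ (mk⇔ (λ a~b → ~-trans a~b b~c) (λ a~c → ~-trans a~c (~-sym b~c))) (a ≟ b) (a ≟ c)

  basis-cong : ∀ {a b} → a ~ b → ∀ c → coeff X (basis a) c ≡ coeff X (basis b) c
  basis-cong {a} {b} a~b c = cong (ℚ._+ 0ℚ) (ind-⇔ (mk⇔ (~-trans (~-sym a~b)) (~-trans a~b)) (a ≟ c) (b ≟ c))

  private
    without : Carrier → Free Carrier → Free Carrier
    without b = filter λ (_ , a) → ¬? (a ≟ b)

    lin-without : ∀ {g} → (∀ {a b} → a ~ b → g a ≡ g b) →
                  ∀ b x → lin g x ≡ coeff X x b ℚ.* g b ℚ.+ lin g (without b x)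
    lin-without {g} g-resp b x = begin
      lin g x
        ≡⟨ sumOver-cong split x ⟩
      sumOver x (λ (q , a) → g b ℚ.* (q ℚ.* ind (a ≟ b)) ℚ.+ ind (¬? (a ≟ b)) ℚ.* (q ℚ.* g a))
        ≡⟨ sumOver-+ x _ _ ⟩
      sumOver x (λ (q , a) → g b ℚ.* (q ℚ.* ind (a ≟ b))) ℚ.+ sumOver x (λ (q , a) → ind (¬? (a ≟ b)) ℚ.* (q ℚ.* g a))
        ≡⟨ cong₂ ℚ._+_ (sumOver-* (g b) x _) (sym (sumOver-filter (λ (_ , a) → ¬? (a ≟ b)) x _)) ⟩
      g b ℚ.* lin (λ a → ind (a ≟ b)) x ℚ.+ lin g (without b x)
        ≡⟨ cong (ℚ._+ lin g (without b x)) (trans (cong (g b ℚ.*_) (sym (coeff-lin x b))) (ℚ.*-comm (g b) _)) ⟩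
      coeff X x b ℚ.* g b ℚ.+ lin g (without b x) ∎
      where
      open ≡-Reasoning
      split : ∀ ((q , a) : ℚ × Carrier) →
              q ℚ.* g a ≡ g b ℚ.* (q ℚ.* ind (a ≟ b)) ℚ.+ ind (¬? (a ≟ b)) ℚ.* (q ℚ.* g a)
      split (q , a) with a ≟ b
      ... | yes a~b = sym (trans (cong₂ ℚ._+_ (cong (g b ℚ.*_) (ℚ.*-identityʳ q)) (ℚ.*-zeroˡ (q ℚ.* g a)))
                          (trans (ℚ.+-identityʳ _) (trans (ℚ.*-comm (g b) q) (cong (q ℚ.*_) (sym (g-resp a~b))))))
      ... | no  _   = sym (trans (cong₂ ℚ._+_ (trans (cong (g b ℚ.*_) (ℚ.*-zeroʳ q)) (ℚ.*-zeroʳ (g b)))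
                                             (ℚ.*-identityˡ (q ℚ.* g a)))
                          (ℚ.+-identityˡ _))

    -- At c ~ b every matching entry has been removed. Elsewhere `lin-without` is applied to the
    -- functional "coefficient at c", whose value at b is 0.
    coeff-without : ∀ b x c → coeff X x c ≡ 0ℚ → coeff X (without b x) c ≡ 0ℚ
    coeff-without b x c x≡0 with c ≟ b
    ... | yes c~b = trans (coeff-lin (without b x) c)
      (trans (sumOver-filter (λ (_ , a) → ¬? (a ≟ b)) x _) (sumOver-zero (All.universal vanish x)))
      where
      vanish : ∀ ((q , a) : ℚ × Carrier) → ind (¬? (a ≟ b)) ℚ.* (q ℚ.* ind (a ≟ c)) ≡ 0ℚ
      vanish (q , a) with a ≟ b
      ... | yes _   = ℚ.*-zeroˡ (q ℚ.* ind (a ≟ c))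
      ... | no  a≁b = trans (ℚ.*-identityˡ _)
        (trans (cong (q ℚ.*_) (ind-false (a ≟ c) (λ a~c → a≁b (~-trans a~c c~b)))) (ℚ.*-zeroʳ q))
    ... | no  c≁b = trans (sym (trans (cong (ℚ._+ coeff X (without b x) c) zero*) (ℚ.+-identityˡ _)))
      (trans (cong (coeff X x b ℚ.* ind (b ≟ c) ℚ.+_) (coeff-lin (without b x) c))
      (trans (sym (lin-without (λ {a} {a′} a~a′ → ind-⇔ (mk⇔ (~-trans (~-sym a~a′)) (~-trans a~a′)) (a ≟ c) (a′ ≟ c)) b x))
      (trans (sym (coeff-lin x c)) x≡0)))
      where
      zero* : coeff X x b ℚ.* ind (b ≟ c) ≡ 0ℚ
      zero* = trans (cong (coeff X x b ℚ.*_) (ind-false (b ≟ c) (c≁b ∘ ~-sym))) (ℚ.*-zeroʳ (coeff X x b))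

    without-∷ : ∀ q a x → without a ((q , a) ∷ x) ≡ without a x
    without-∷ q a x with a ≟ a
    ... | yes _   = refl
    ... | no  a≁a = contradiction ~-refl a≁a

    -- Vanishing coefficients do not make the list empty. All entries equivalent to the head are
    -- collected into one term with coefficient 0; removing them shortens the list, and k bounds its
    -- length.
    lin-≈0 : ∀ {g} → (∀ {a b} → a ~ b → g a ≡ g b) →
             ∀ k x → length x ≤ k → (∀ c → coeff X x c ≡ 0ℚ) → lin g x ≡ 0ℚ
    lin-≈0 g-resp k       []              _         x≈0 = refl
    lin-≈0 {g} g-resp (suc k) xs@((q , a) ∷ x) (s≤s len≤) x≈0 =
      trans (lin-without g-resp a xs)
      (trans (cong₂ ℚ._+_ (trans (cong (ℚ._* g a) (x≈0 a)) (ℚ.*-zeroˡ (g a))) rest) refl)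
      where
      rest : lin g (without a xs) ≡ 0ℚ
      rest = lin-≈0 g-resp k (without a xs)
        (subst (λ y → length y ≤ k) (sym (without-∷ q a x)) (ℕ.≤-trans (length-filter (λ (_ , b) → ¬? (b ≟ a)) x) len≤))
        (λ c → coeff-without a xs c (x≈0 c))

  lin-cong : ∀ {g} → (∀ {a b} → a ~ b → g a ≡ g b) →
             ∀ x y → (∀ c → coeff X x c ≡ coeff X y c) → lin g x ≡ lin g y
  lin-cong {g} g-resp x y x≈y = x∙y⁻¹≈ε⇒x≈y (lin g x) (lin g y) (trans (sym (lin-diff g)) diff≡0)
    where
    lin-diff : ∀ h → lin h (x ⊕ (ℚ.- 1ℚ) • y) ≡ lin h x ℚ.- lin h y
    lin-diff h = trans (lin-⊕ h x _) (cong (lin h x ℚ.+_)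
      (trans (lin-• h (ℚ.- 1ℚ) y) (trans (sym (ℚ.neg-distribˡ-* 1ℚ (lin h y))) (cong ℚ.-_ (ℚ.*-identityˡ (lin h y))))))

    diff≡0 : lin g (x ⊕ (ℚ.- 1ℚ) • y) ≡ 0ℚ
    diff≡0 = lin-≈0 g-resp _ (x ⊕ (ℚ.- 1ℚ) • y) ℕ.≤-refl λ c →
      trans (coeff-lin (x ⊕ (ℚ.- 1ℚ) • y) c) (trans (lin-diff _)
      (trans (cong₂ ℚ._-_ (sym (coeff-lin x c)) (sym (coeff-lin y c)))
      (trans (cong (ℚ._- coeff X y c) (x≈y c)) (ℚ.+-inverseʳ (coeff X y c)))))

-- Integers as rationals

-- Normalized fractions do not add by computation. In `ℚᵘ` the claim is a cross-multiplication, and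
-- `toℚᵘ` is additive and injective.
/1-+ : ∀ i j → (i ℤ.+ j) / 1 ≡ i / 1 ℚ.+ j / 1
/1-+ i j = ℚ.toℚᵘ-injective (begin
  toℚᵘ ((i ℤ.+ j) / 1)             ≈⟨ ℚ.toℚᵘ-fromℚᵘ ((i ℤ.+ j) ℚᵘ./ 1) ⟩
  (i ℤ.+ j) ℚᵘ./ 1                 ≈⟨ ℚᵘ.*≡* (cong (ℤ._* pos 1) (sym (cong₂ ℤ._+_ (ℤ.*-identityʳ i) (ℤ.*-identityʳ j)))) ⟩
  (i ℚᵘ./ 1) ℚᵘ.+ (j ℚᵘ./ 1)       ≈⟨ ℚᵘ.+-cong (ℚ.toℚᵘ-fromℚᵘ (i ℚᵘ./ 1)) (ℚ.toℚᵘ-fromℚᵘ (j ℚᵘ./ 1)) ⟨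
  toℚᵘ (i / 1) ℚᵘ.+ toℚᵘ (j / 1)   ≈⟨ ℚ.toℚᵘ-homo-+ (i / 1) (j / 1) ⟨
  toℚᵘ (i / 1 ℚ.+ j / 1)           ∎)
  where open import Relation.Binary.Reasoning.Setoid ℚᵘ.≃-setoid

/1-neg : ∀ i → (ℤ.- i) / 1 ≡ ℚ.- (i / 1)
/1-neg i = inverseˡ-unique _ _ (trans (sym (/1-+ (ℤ.- i) i)) (cong (_/ 1) (ℤ.+-inverseˡ i)))

length-filter-/1 : ∀ {P : A → Set} (P? : ∀ x → Dec (P x)) xs →
                   (pos (length (filter P? xs))) / 1 ≡ sumOver xs (ind ∘ P?)
length-filter-/1 P? []       = refl
length-filter-/1 P? (x ∷ xs) with does (P? x)
... | true  = trans (/1-+ (pos 1) (pos (length (filter P? xs)))) (cong (1ℚ ℚ.+_) (length-filter-/1 P? xs))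
... | false = trans (length-filter-/1 P? xs) (sym (ℚ.+-identityˡ _))

-- Applied to the evenness of #J this is (-1)^(#J+1), so odd J count positively, as in λ.
sign : Dec P → ℚ
sign E? = if does E? then ℚ.- 1ℚ else 1ℚ

sign-⇔ : P ⇔ Q → (P? : Dec P) (Q? : Dec Q) → sign P? ≡ sign Q?
sign-⇔ P⇔Q P? Q? = cong (if_then ℚ.- 1ℚ else 1ℚ) (does-⇔ P⇔Q P? Q?)

odd-even-count : ∀ {D E : A → Set} (D? : ∀ x → Dec (D x)) (E? : ∀ x → Dec (E x)) xs →
  (pos (length (filter (λ x → D? x ×-dec ¬? (E? x)) xs)) ℤ.- pos (length (filter (λ x → D? x ×-dec E? x) xs))) / 1
    ≡ sumOver xs (λ x → sign (E? x) ℚ.* ind (D? x))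
odd-even-count D? E? xs = begin
  (pos (length (filter odd? xs)) ℤ.- pos (length (filter even? xs))) / 1
    ≡⟨ /1-+ (pos (length (filter odd? xs))) (ℤ.- pos (length (filter even? xs))) ⟩
  (pos (length (filter odd? xs))) / 1 ℚ.+ (ℤ.- pos (length (filter even? xs))) / 1
    ≡⟨ cong₂ ℚ._+_ (length-filter-/1 odd? xs)
         (trans (/1-neg (pos (length (filter even? xs)))) (cong ℚ.-_ (length-filter-/1 even? xs))) ⟩
  sumOver xs (ind ∘ odd?) ℚ.- sumOver xs (ind ∘ even?)
    ≡⟨ cong (sumOver xs (ind ∘ odd?) ℚ.+_) (sumOver-neg xs (ind ∘ even?)) ⟨
  sumOver xs (ind ∘ odd?) ℚ.+ sumOver xs (λ x → ℚ.- ind (even? x))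
    ≡⟨ sumOver-+ xs _ _ ⟨
  sumOver xs (λ x → ind (odd? x) ℚ.- ind (even? x))
    ≡⟨ sumOver-cong pointwise xs ⟩
  sumOver xs (λ x → sign (E? x) ℚ.* ind (D? x)) ∎
  where
  open ≡-Reasoning
  odd?  = λ x → D? x ×-dec ¬? (E? x)
  even? = λ x → D? x ×-dec E? x
  pointwise : ∀ x → ind (odd? x) ℚ.- ind (even? x) ≡ sign (E? x) ℚ.* ind (D? x)
  pointwise x with does (D? x) | does (E? x)
  ... | true  | true  = refl
  ... | true  | false = refl
  ... | false | true  = refl
  ... | false | false = refl

-- Permutations

flip-cong : ∀ (u v : Permutation′ n) → u Perm.≈ v → flip u Perm.≈ flip v
flip-cong u v u≈v i =
  trans (sym (Perm.inverseˡ v)) (cong (v ⟨$⟩ˡ_) (trans (sym (u≈v (u ⟨$⟩ˡ i))) (Perm.inverseʳ u)))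

⟨$⟩ʳ-injective : ∀ (u : Permutation′ n) {i j} → u ⟨$⟩ʳ i ≡ u ⟨$⟩ʳ j → i ≡ j
⟨$⟩ʳ-injective u eq = trans (sym (Perm.inverseˡ u)) (trans (cong (u ⟨$⟩ˡ_) eq) (Perm.inverseˡ u))

×ₚ-↑ˡ : ∀ (x : Permutation′ p) (y : Permutation′ q) i → (x ×ₚ y) ⟨$⟩ʳ (i ↑ˡ q) ≡ (x ⟨$⟩ʳ i) ↑ˡ q
×ₚ-↑ˡ {p} {q} x y i = cong (join p q ∘ Sum.map (x ⟨$⟩ʳ_) (y ⟨$⟩ʳ_)) (Fin.splitAt-↑ˡ p i q)

×ₚ-↑ʳ : ∀ (x : Permutation′ p) (y : Permutation′ q) i → (x ×ₚ y) ⟨$⟩ʳ (p ↑ʳ i) ≡ p ↑ʳ (y ⟨$⟩ʳ i)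
×ₚ-↑ʳ {p} {q} x y i = cong (join p q ∘ Sum.map (x ⟨$⟩ʳ_) (y ⟨$⟩ʳ_)) (Fin.splitAt-↑ʳ p q i)

×ₚ-cong : ∀ (x x′ : Permutation′ p) (y y′ : Permutation′ q) →
          x Perm.≈ x′ → y Perm.≈ y′ → (x ×ₚ y) Perm.≈ (x′ ×ₚ y′)
×ₚ-cong {p} {q} x x′ y y′ x≈ y≈ k with splitAt p k
... | inj₁ i = cong (_↑ˡ q) (x≈ i)
... | inj₂ j = cong (p ↑ʳ_) (y≈ j)

-- Sorting permutations and standardization.

StrictMono : (Fin n → ℕ) → Set
StrictMono {n} f = ∀ (i j : Fin n) → i Fin.< j → f i < f j

strictMono? : (f : Fin n → ℕ) → Dec (StrictMono f)
strictMono? f = Fin.all? λ i → Fin.all? λ j → (i Fin.<? j) →-dec (f i ℕ.<? f j)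

strictMono-reflects : ∀ {f : Fin n → ℕ} → StrictMono f → ∀ {i j} → f i < f j → i Fin.< j
strictMono-reflects {f = f} mono {i} {j} fi<fj = ℕ.≰⇒> λ j≤i → ℕ.<⇒≱ fi<fj (weaken j≤i)
  where
  weaken : toℕ j ≤ toℕ i → f j ≤ f i
  weaken j≤i with j Fin.≟ i
  ... | yes refl = ℕ.≤-refl
  ... | no  j≢i  = ℕ.<⇒≤ (mono j i (ℕ.≤∧≢⇒< j≤i (j≢i ∘ Fin.toℕ-injective)))

strictMono-expansive : ∀ {f : Fin n → ℕ} → StrictMono f → ∀ i → toℕ i ≤ f i
strictMono-expansive {f = f} mono i = go (toℕ i) i refl
  where
  go : ∀ k i → toℕ i ≡ k → k ≤ f i
  go zero    i       _  = z≤n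
  go (suc k) (suc i) eq = ℕ.≤-<-trans (go k (inject₁ i) (trans (Fin.toℕ-inject₁ i) (ℕ.suc-injective eq)))
    (mono (inject₁ i) (suc i) (subst (_< suc (toℕ i)) (sym (Fin.toℕ-inject₁ i)) (ℕ.n<1+n _)))

-- The composite v⁻¹u is strictly increasing, since f ∘ v reflects the order; hence it moves no
-- index down. The same holds for u⁻¹v, so both are the identity.
sorting-unique : ∀ (f : Fin n → ℕ) (u v : Permutation′ n) →
                 StrictMono (f ∘ (u ⟨$⟩ʳ_)) → StrictMono (f ∘ (v ⟨$⟩ʳ_)) → u Perm.≈ v
sorting-unique f u v mono-u mono-v i = trans (sym (Perm.inverseʳ v)) (cong (v ⟨$⟩ʳ_) (sym i≡))
  where
  expansive : ∀ u v → StrictMono (f ∘ (u ⟨$⟩ʳ_)) → StrictMono (f ∘ (v ⟨$⟩ʳ_)) →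
              ∀ i → toℕ i ≤ toℕ (v ⟨$⟩ˡ (u ⟨$⟩ʳ i))
  expansive u v mono-u mono-v = strictMono-expansive λ i j i<j → strictMono-reflects mono-v
    (subst₂ _<_ (cong f (sym (Perm.inverseʳ v))) (cong f (sym (Perm.inverseʳ v))) (mono-u i j i<j))

  i≡ : i ≡ v ⟨$⟩ˡ (u ⟨$⟩ʳ i)
  i≡ = Fin.toℕ-injective (ℕ.≤-antisym (expansive u v mono-u mono-v i)
    (ℕ.≤-trans (expansive v u mono-v mono-u (v ⟨$⟩ˡ (u ⟨$⟩ʳ i)))
    (ℕ.≤-reflexive (cong toℕ (trans (cong (u ⟨$⟩ˡ_) (Perm.inverseʳ v)) (Perm.inverseˡ u))))))

st-sorts : ∀ (f : Fin n → ℕ) → Injective _≡_ _≡_ f → StrictMono (f ∘ (flip (st f) ⟨$⟩ʳ_))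
st-sorts f inj i j i<j = Equivalence.from (st-order f inj _ _)
  (subst₂ _<_ (cong toℕ (sym (Perm.inverseʳ (st f)))) (cong toℕ (sym (Perm.inverseʳ (st f)))) i<j)

-- The inverses of both permutations sort the one-line word of v.
st-oneLine : ∀ (v : Permutation′ n) → st (oneLine v) Perm.≈ v
st-oneLine v = flip-cong (flip (st (oneLine v))) (flip v)
  (sorting-unique (oneLine v) (flip (st (oneLine v))) (flip v)
    (st-sorts (oneLine v) (⟨$⟩ʳ-injective v ∘ Fin.toℕ-injective))
    (λ i j → subst₂ _<_ (cong toℕ (sym (Perm.inverseʳ v))) (cong toℕ (sym (Perm.inverseʳ v)))))

-- `st` inserts the rank of the first entry among the later ones, and this rank depends only on
-- comparisons of later entries with the first.
st-cong : ∀ {a b : Fin n → ℕ} → (∀ i j → a i < a j ⇔ b i < b j) → st a Perm.≈ st b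
st-cong {suc n} {a} {b} a~b = λ
  { zero    → rank
  ; (suc i) → cong₂ punchIn rank (st-cong (λ i j → a~b (suc i) (suc j)) i)
  }
  where
  rank = Fin.fromℕ<-cong _ _ (cong ∣_∣ (Vec.tabulate-cong λ j → does-⇔ (a~b (suc j) zero) (_ ℕ.<? _) (_ ℕ.<? _))) _ _

st-≗ : ∀ {a b : Fin n → ℕ} → (∀ i → a i ≡ b i) → st a Perm.≈ st b
st-≗ eq = st-cong λ i j → mk⇔ (subst₂ _<_ (eq i) (eq j)) (subst₂ _<_ (sym (eq i)) (sym (eq j)))

stBlocks-≗ : ∀ cs {a b} → (∀ i → a i ≡ b i) → stBlocks cs a Perm.≈ stBlocks cs b
stBlocks-≗ []       eq = λ ()
stBlocks-≗ (c ∷ cs) {a} {b} eq =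
  ×ₚ-cong (st (a ∘ (_↑ˡ sum cs))) (st (b ∘ (_↑ˡ sum cs))) (stBlocks cs (a ∘ (c ↑ʳ_))) (stBlocks cs (b ∘ (c ↑ʳ_)))
    (st-≗ (eq ∘ (_↑ˡ sum cs))) (stBlocks-≗ cs (eq ∘ (c ↑ʳ_)))

-- Q is the condition on a summand, R the condition that some summand survives. The list holds one
-- representative of each class under pointwise equality, so a given solution is only equivalent to
-- a listed one; this is where the invariance of Q enters.
sumOver-permutations : ∀ {Q : Permutation′ n → Set} {R : Set} (Q? : ∀ u → Dec (Q u)) (R? : Dec R) →
                       (∀ u v → Q u → Q v → u Perm.≈ v) → (∀ u v → u Perm.≈ v → Q u → Q v) →
                       (∀ u → Q u → R) → (R → ∃ Q) → sumOver (permutations n) (ind ∘ Q?) ≡ ind R?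
sumOver-permutations {n} Q? (yes r) uniq resp _ exists with u , qu ← exists r =
  sumOver-ind-unique {_~_ = Perm._≈_} Q? (λ {v} {w} → uniq v w) (permutations-unique n)
    (Any.map (λ {v} v≈u → resp u v (λ i → sym (v≈u i)) qu) (permutations-complete u))
sumOver-permutations {n} Q? (no ¬r) _ _ Q⇒R _ =
  sumOver-zero (All.universal (λ u → ind-false (Q? u) (¬r ∘ Q⇒R u)) (permutations n))

-- The recursion follows that of `stBlocks`, so that a block is split off together with one factor
-- of the product. For `gaps 1 J` the condition becomes Des ⊆ J, see `Des⊆⇔incBlocks`.
IncBlocks : (cs : List ℕ) → (Fin (sum cs) → ℕ) → Set
IncBlocks []       f = ⊤
IncBlocks (c ∷ cs) f = StrictMono (f ∘ (_↑ˡ sum cs)) × IncBlocks cs (f ∘ (c ↑ʳ_))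

incBlocks? : ∀ cs f → Dec (IncBlocks cs f)
incBlocks? []       f = yes tt
incBlocks? (c ∷ cs) f = strictMono? (f ∘ (_↑ˡ sum cs)) ×-dec incBlocks? cs (f ∘ (c ↑ʳ_))

incBlocks-map : ∀ cs {f g} → (∀ i j → f i < f j → g i < g j) → IncBlocks cs f → IncBlocks cs g
incBlocks-map []       f⇒g _            = tt
incBlocks-map (c ∷ cs) f⇒g (mono , inc) =
  (λ i j i<j → f⇒g _ _ (mono i j i<j)) , incBlocks-map cs (λ i j → f⇒g _ _) inc

incBlocks-≗ : ∀ cs {f g} → (∀ i → f i ≡ g i) → IncBlocks cs f → IncBlocks cs g
incBlocks-≗ cs eq = incBlocks-map cs λ i j → subst₂ _<_ (eq i) (eq j)

-- Coefficients in 𝔖Sym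

coeff𝔖 : 𝔖Sym → 𝔖 → ℚ
coeff𝔖 = coeff 𝔖-decSetoid

same⁻¹ : ∀ {u v : Permutation′ n} → (n , u) ≈𝔖 (n , v) → u Perm.≈ v
same⁻¹ (same u≈v) = u≈v

degree : ∀ {x y} → x ≈𝔖 y → proj₁ x ≡ proj₁ y
degree (same _) = refl

coeff-∑ℱ : ∀ (xs : List A) (φ : A → Permutation′ n) b →
           coeff𝔖 (∑ xs (ℱ ∘ φ)) b ≡ sumOver xs (λ x → ind ((n , φ x) ≟𝔖 b))
coeff-∑ℱ xs φ b = trans (coeff-lin 𝔖-decSetoid (∑ xs (ℱ ∘ φ)) b)
  (trans (lin-∑ _ xs (ℱ ∘ φ)) (sumOver-cong (λ x → lin-basis (λ a → ind (a ≟𝔖 b)) (_ , φ x)) xs))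

coeff-∑ℱ-degree : ∀ (xs : List A) (φ : A → Permutation′ n) {b} → proj₁ b ≢ n → coeff𝔖 (∑ xs (ℱ ∘ φ)) b ≡ 0ℚ
coeff-∑ℱ-degree {n = n} xs φ {b} ≢n = trans (coeff-∑ℱ xs φ b)
  (sumOver-zero (All.universal (λ x → ind-false ((n , φ x) ≟𝔖 b) (≢n ∘ sym ∘ degree)) xs))

coeff-∑ℱ-filter : ∀ {P : A → Set} (P? : ∀ x → Dec (P x)) xs (φ : A → Permutation′ n) w →
  coeff𝔖 (∑ (filter P? xs) (ℱ ∘ φ)) (n , w) ≡ sumOver xs (λ x → ind (P? x ×-dec ((n , φ x) ≟𝔖 (n , w))))
coeff-∑ℱ-filter P? xs φ w = trans (coeff-∑ℱ (filter P? xs) φ _)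
  (trans (sumOver-filter P? xs _) (sumOver-cong (λ x → ind-× (P? x) ((_ , φ x) ≟𝔖 (_ , w))) xs))

𝟙 : {P : Permutation′ n → Set} → (∀ u → Dec (P u)) → 𝔖Sym
𝟙 {n} P? = ∑ (filter P? (permutations n)) ℱ

coeff-𝟙 : ∀ {P : Permutation′ n → Set} (P? : ∀ u → Dec (P u)) → (∀ u v → u Perm.≈ v → P u → P v) →
          ∀ w → coeff𝔖 (𝟙 P?) (n , w) ≡ ind (P? w)
coeff-𝟙 {n} P? resp w = trans (coeff-∑ℱ-filter P? (permutations n) (λ u → u) w)
  (sumOver-permutations (λ u → P? u ×-dec ((n , u) ≟𝔖 (n , w))) (P? w)
    (λ u v (_ , u≈w) (_ , v≈w) i → trans (same⁻¹ u≈w i) (sym (same⁻¹ v≈w i)))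
    (λ u v u≈v (pu , u≈w) → resp u v u≈v pu , same λ i → trans (sym (u≈v i)) (same⁻¹ u≈w i))
    (λ u (pu , u≈w) → resp u w (same⁻¹ u≈w) pu)
    (λ pw → w , pw , same λ _ → refl))

isShuffle-resp : ∀ p q (ζ ξ : Permutation′ (p + q)) → ζ Perm.≈ ξ → IsShuffle p q ζ → IsShuffle p q ξ
isShuffle-resp p q ζ ξ ζ≈ξ (l , r) =
  (λ i j i<j → subst₂ Fin._<_ (ζ≈ξ _) (ζ≈ξ _) (l i j i<j)) ,
  (λ i j i<j → subst₂ Fin._<_ (ζ≈ξ _) (ζ≈ξ _) (r i j i<j))

-- The equation (u × v)ζ⁻¹ = w has the only solution ζ = w⁻¹(u × v), so the coefficient is 0 or 1.
coeff-product : ∀ (u : Permutation′ p) (v : Permutation′ q) w →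
  coeff𝔖 (product ((p , u) , (q , v))) (p + q , w) ≡ ind (isShuffle? p q (flip w · (u ×ₚ v)))
coeff-product {p} {q} u v w =
  trans (coeff-∑ℱ-filter (isShuffle? p q) (permutations (p + q)) (λ ζ → (u ×ₚ v) · flip ζ) w)
  (sumOver-permutations
    (λ ζ → isShuffle? p q ζ ×-dec ((p + q , (u ×ₚ v) · flip ζ) ≟𝔖 (p + q , w)))
    (isShuffle? p q (flip w · (u ×ₚ v)))
    (λ ζ ξ (_ , eq) (_ , eq′) i → trans (solve ζ (same⁻¹ eq) i) (sym (solve ξ (same⁻¹ eq′) i)))
    (λ ζ ξ ζ≈ξ (sh , eq) → isShuffle-resp p q ζ ξ ζ≈ξ sh , same λ i →
         trans (cong ((u ×ₚ v) ⟨$⟩ʳ_) (sym (flip-cong ζ ξ ζ≈ξ i))) (same⁻¹ eq i))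
    (λ ζ (sh , eq) → isShuffle-resp p q ζ (flip w · (u ×ₚ v)) (solve ζ (same⁻¹ eq)) sh)
    (λ sh → flip w · (u ×ₚ v) , sh , same λ i → Perm.inverseʳ (u ×ₚ v)))
  where
  solve : ∀ ζ → ((u ×ₚ v) · flip ζ) Perm.≈ w → ζ Perm.≈ (flip w · (u ×ₚ v))
  solve ζ eq i = trans (sym (Perm.inverseˡ w)) (cong (w ⟨$⟩ˡ_)
    (trans (sym (eq (ζ ⟨$⟩ʳ i))) (cong ((u ×ₚ v) ⟨$⟩ʳ_) (Perm.inverseˡ ζ))))

productCoeff : 𝔖 → 𝔖 → 𝔖 → ℚ
productCoeff b x y = coeff𝔖 (product (x , y)) b

productCoeff-degree : ∀ {b x y} → proj₁ b ≢ proj₁ x + proj₁ y → productCoeff b x y ≡ 0ℚ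
productCoeff-degree {b} {p , u} {q , v} ≢p+q = coeff-∑ℱ-degree
  (filter (isShuffle? p q) (permutations (p + q))) (λ ζ → (u ×ₚ v) · flip ζ) {b} ≢p+q

productCoeff-cong : ∀ b {x x′ y y′} → x ≈𝔖 x′ → y ≈𝔖 y′ → productCoeff b x y ≡ productCoeff b x′ y′
productCoeff-cong (n , w) {p , u} {.p , u′} {q , v} {.q , v′} (same u≈) (same v≈) with n ℕ.≟ p + q
... | no  n≢   = trans (productCoeff-degree {n , w} {p , u} {q , v} n≢)
  (sym (productCoeff-degree {n , w} {p , u′} {q , v′} n≢))
... | yes refl = trans (coeff-product u v w) (trans
  (ind-⇔ (mk⇔ (isShuffle-resp p q f g f≈g) (isShuffle-resp p q g f (sym ∘ f≈g))) (isShuffle? p q f) (isShuffle? p q g))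
  (sym (coeff-product u′ v′ w)))
  where
  f = flip w · (u ×ₚ v)
  g = flip w · (u′ ×ₚ v′)
  f≈g : f Perm.≈ g
  f≈g i = cong (w ⟨$⟩ˡ_) (×ₚ-cong u u′ v v′ u≈ v≈ i)

productCoeff-congʳ : ∀ b x {y y′} → y ≈𝔖 y′ → productCoeff b x y ≡ productCoeff b x y′
productCoeff-congʳ b x {y} {y′} = productCoeff-cong b {x} {x} {y} {y′} (same λ _ → refl)

-- With an empty first factor the shuffle condition says that w⁻¹v increases everywhere. This forces
-- v = w, as both sort the one-line word of w⁻¹.
productCoeff-identityˡ : ∀ b y → productCoeff b (0 , Perm.id) y ≡ ind (y ≟𝔖 b)
productCoeff-identityˡ (n , w) (q , v) with n ℕ.≟ q
... | no  n≢q  = trans (productCoeff-degree {n , w} {0 , Perm.id} {q , v} n≢q)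
  (sym (ind-false ((q , v) ≟𝔖 (n , w)) (n≢q ∘ sym ∘ degree)))
... | yes refl = trans (coeff-product Perm.id v w)
  (ind-⇔ (mk⇔ to from) (isShuffle? 0 q (flip w · (Perm.id ×ₚ v))) ((q , v) ≟𝔖 (q , w)))
  where
  to : IsShuffle 0 q (flip w · (Perm.id ×ₚ v)) → (q , v) ≈𝔖 (q , w)
  to (_ , mono) = same (sorting-unique (oneLine (flip w)) v w mono
    λ i j → subst₂ _<_ (cong toℕ (sym (Perm.inverseˡ w))) (cong toℕ (sym (Perm.inverseˡ w))))

  from : (q , v) ≈𝔖 (q , w) → IsShuffle 0 q (flip w · (Perm.id ×ₚ v))
  from eq = (λ ()) , λ i j → subst₂ _<_ (undo i) (undo j)
    where
    undo : ∀ i → toℕ i ≡ toℕ (w ⟨$⟩ˡ (v ⟨$⟩ʳ i))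
    undo i = cong toℕ (sym (trans (cong (w ⟨$⟩ˡ_) (same⁻¹ eq i)) (Perm.inverseˡ w)))

-- Iterated products

IncFrom : ∀ cs → Permutation′ (sum cs) → Permutation′ (sum cs) → Set
IncFrom cs y w = IncBlocks cs (oneLine (flip w · y))

incFrom? : ∀ cs y w → Dec (IncFrom cs y w)
incFrom? cs y w = incBlocks? cs (oneLine (flip w · y))

incFrom-resp : ∀ cs y w w′ → w Perm.≈ w′ → IncFrom cs y w → IncFrom cs y w′
incFrom-resp cs y w w′ w≈ = incBlocks-≗ cs λ i → cong toℕ (flip-cong w w′ w≈ (y ⟨$⟩ʳ i))

-- The closed form survives multiplication by ℱ_x from the left: the coefficient at w counts the w′
-- that satisfy both the block condition and the shuffle condition, and the latter leaves at most
-- one candidate, so no multiplicities arise.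
product-𝟙 : ∀ c cs (x : Permutation′ c) (y : Permutation′ (sum cs)) b →
            lin (productCoeff b (c , x)) (𝟙 (incFrom? cs y)) ≡ coeff𝔖 (𝟙 (incFrom? (c ∷ cs) (x ×ₚ y))) b
product-𝟙 c cs x y b@(n , w) = trans (lin-∑ (productCoeff b (c , x)) ws ℱ)
  (trans (sumOver-cong (λ w′ → lin-basis (productCoeff b (c , x)) (sum cs , w′)) ws) (by-degree (n ℕ.≟ c + sum cs)))
  where
  ws = filter (incFrom? cs y) (permutations (sum cs))
  by-degree : Dec (n ≡ c + sum cs) →
              sumOver ws (λ w′ → productCoeff b (c , x) (sum cs , w′)) ≡ coeff𝔖 (𝟙 (incFrom? (c ∷ cs) (x ×ₚ y))) b
  by-degree (no n≢) = trans
    (sumOver-zero (All.universal (λ w′ → productCoeff-degree {b} {c , x} {sum cs , w′} n≢) ws))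
    (sym (coeff-∑ℱ-degree (filter (incFrom? (c ∷ cs) (x ×ₚ y)) (permutations (c + sum cs))) (λ u → u) {b} n≢))
  by-degree (yes refl) = begin
    sumOver ws (λ w′ → productCoeff b (c , x) (sum cs , w′))
      ≡⟨ sumOver-cong (λ w′ → coeff-product x w′ w) ws ⟩
    sumOver ws (λ w′ → ind (shuffle? w′))
      ≡⟨ sumOver-filter (incFrom? cs y) (permutations (sum cs)) _ ⟩
    sumOver (permutations (sum cs)) (λ w′ → ind (incFrom? cs y w′) ℚ.* ind (shuffle? w′))
      ≡⟨ sumOver-cong (λ w′ → ind-× (incFrom? cs y w′) (shuffle? w′)) (permutations (sum cs)) ⟩
    sumOver (permutations (sum cs)) (λ w′ → ind (incFrom? cs y w′ ×-dec shuffle? w′))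
      ≡⟨ sumOver-permutations (λ w′ → incFrom? cs y w′ ×-dec shuffle? w′) (incFrom? (c ∷ cs) (x ×ₚ y) w)
           uniq resp sound complete ⟩
    ind (incFrom? (c ∷ cs) (x ×ₚ y) w)
      ≡⟨ coeff-𝟙 (incFrom? (c ∷ cs) (x ×ₚ y)) (incFrom-resp (c ∷ cs) (x ×ₚ y)) w ⟨
    coeff𝔖 (𝟙 (incFrom? (c ∷ cs) (x ×ₚ y))) (n , w) ∎
    where
    open ≡-Reasoning
    Shuffle : Permutation′ (sum cs) → Set
    Shuffle w′ = IsShuffle c (sum cs) (flip w · (x ×ₚ w′))

    shuffle? : ∀ w′ → Dec (Shuffle w′)
    shuffle? w′ = isShuffle? c (sum cs) (flip w · (x ×ₚ w′))

    f : Fin (sum cs) → ℕ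
    f j = toℕ (w ⟨$⟩ˡ (c ↑ʳ j))

    f-injective : Injective _≡_ _≡_ f
    f-injective eq = Fin.↑ʳ-injective c _ _ (⟨$⟩ʳ-injective (flip w) (Fin.toℕ-injective eq))

    onˡ : ∀ z i → toℕ (w ⟨$⟩ˡ ((x ×ₚ z) ⟨$⟩ʳ (i ↑ˡ sum cs))) ≡ toℕ (w ⟨$⟩ˡ ((x ⟨$⟩ʳ i) ↑ˡ sum cs))
    onˡ z i = cong (toℕ ∘ (w ⟨$⟩ˡ_)) (×ₚ-↑ˡ x z i)

    onʳ : ∀ z i → toℕ (w ⟨$⟩ˡ ((x ×ₚ z) ⟨$⟩ʳ (c ↑ʳ i))) ≡ f (z ⟨$⟩ʳ i)
    onʳ z i = cong (toℕ ∘ (w ⟨$⟩ˡ_)) (×ₚ-↑ʳ x z i)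

    sorts : ∀ w′ → Shuffle w′ → StrictMono (f ∘ (w′ ⟨$⟩ʳ_))
    sorts w′ (_ , r) i j i<j = subst₂ _<_ (onʳ w′ i) (onʳ w′ j) (r i j i<j)

    uniq : ∀ w₁ w₂ → IncFrom cs y w₁ × Shuffle w₁ → IncFrom cs y w₂ × Shuffle w₂ → w₁ Perm.≈ w₂
    uniq w₁ w₂ (_ , sh₁) (_ , sh₂) = sorting-unique f w₁ w₂ (sorts w₁ sh₁) (sorts w₂ sh₂)

    resp : ∀ w₁ w₂ → w₁ Perm.≈ w₂ → IncFrom cs y w₁ × Shuffle w₁ → IncFrom cs y w₂ × Shuffle w₂
    resp w₁ w₂ w≈ (inc , sh) = incFrom-resp cs y w₁ w₂ w≈ inc ,
      isShuffle-resp c (sum cs) (flip w · (x ×ₚ w₁)) (flip w · (x ×ₚ w₂))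
        (λ i → cong (w ⟨$⟩ˡ_) (×ₚ-cong x x w₁ w₂ (λ _ → refl) w≈ i)) sh

    -- On the second block w⁻¹(x × y) is w′⁻¹y followed by f ∘ w′. Once f ∘ w′ is increasing, the
    -- block condition passes between w′⁻¹y and w⁻¹(x × y) in both directions.
    refactor : ∀ w′ i → f (w′ ⟨$⟩ʳ (w′ ⟨$⟩ˡ (y ⟨$⟩ʳ i))) ≡ toℕ (w ⟨$⟩ˡ ((x ×ₚ y) ⟨$⟩ʳ (c ↑ʳ i)))
    refactor w′ i = trans (cong f (Perm.inverseʳ w′)) (sym (onʳ y i))

    sound : ∀ w′ → IncFrom cs y w′ × Shuffle w′ → IncFrom (c ∷ cs) (x ×ₚ y) w
    sound w′ (inc , sh@(l , _)) =
      (λ i j i<j → subst₂ _<_ (trans (onˡ w′ i) (sym (onˡ y i))) (trans (onˡ w′ j) (sym (onˡ y j))) (l i j i<j)) ,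
      incBlocks-map cs (λ i j lt → subst₂ _<_ (refactor w′ i) (refactor w′ j) (sorts w′ sh _ _ lt)) inc

    complete : IncFrom (c ∷ cs) (x ×ₚ y) w → ∃ λ w′ → IncFrom cs y w′ × Shuffle w′
    complete (mono , inc) = w′ ,
      incBlocks-map cs (λ i j lt → strictMono-reflects mono-w′
        (subst₂ _<_ (sym (refactor w′ i)) (sym (refactor w′ j)) lt)) inc ,
      (λ i j i<j → subst₂ _<_ (trans (onˡ y i) (sym (onˡ w′ i))) (trans (onˡ y j) (sym (onˡ w′ j))) (mono i j i<j)) ,
      (λ i j i<j → subst₂ _<_ (sym (onʳ w′ i)) (sym (onʳ w′ j)) (mono-w′ i j i<j))
      where
      -- The inverse is taken because `st f` sends positions to ranks, while sorting sends ranks to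
      -- positions.
      w′ = flip (st f)
      mono-w′ = st-sorts f f-injective

-- Stands for the product of the ℱ of the standardized blocks, given directly by its closed form;
-- `product-𝟙` shows that prepending a block is multiplication by its ℱ from the left.
blockProduct : ∀ cs → (Fin (sum cs) → ℕ) → 𝔖Sym
blockProduct cs f = 𝟙 (incFrom? cs (stBlocks cs f))

coeff-blockProduct : ∀ cs f w → coeff𝔖 (blockProduct cs f) (sum cs , w) ≡ ind (incFrom? cs (stBlocks cs f) w)
coeff-blockProduct cs f = coeff-𝟙 (incFrom? cs (stBlocks cs f)) (incFrom-resp cs (stBlocks cs f))

coeff-blockProduct-degree : ∀ cs f {b} → proj₁ b ≢ sum cs → coeff𝔖 (blockProduct cs f) b ≡ 0ℚ
coeff-blockProduct-degree cs f {b} =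
  coeff-∑ℱ-degree (filter (incFrom? cs (stBlocks cs f)) (permutations (sum cs))) (λ u → u) {b}

blockProduct-≗ : ∀ cs {f g} → (∀ i → f i ≡ g i) → blockProduct cs f ≈ blockProduct cs g
blockProduct-≗ cs {f} {g} eq b@(n , w) with n ℕ.≟ sum cs
... | no n≢    = trans (coeff-blockProduct-degree cs f {b} n≢) (sym (coeff-blockProduct-degree cs g {b} n≢))
... | yes refl = trans (coeff-blockProduct cs f w) (trans
  (ind-⇔ (mk⇔ (incBlocks-≗ cs (λ i → eq′ i)) (incBlocks-≗ cs (λ i → sym (eq′ i))))
    (incFrom? cs (stBlocks cs f) w) (incFrom? cs (stBlocks cs g) w))
  (sym (coeff-blockProduct cs g w)))
  where
  eq′ : ∀ i → toℕ (w ⟨$⟩ˡ (stBlocks cs f ⟨$⟩ʳ i)) ≡ toℕ (w ⟨$⟩ˡ (stBlocks cs g ⟨$⟩ʳ i))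
  eq′ i = cong (toℕ ∘ (w ⟨$⟩ˡ_)) (stBlocks-≗ cs eq i)

-- Using total sequences ℕ → ℕ makes splitting off a block a shift of the
-- argument, so that no casts between Fin n and Fin (p + (n ∸ p)) are needed.
prefix : ℕ → (ℕ → ℕ) → 𝔖
prefix n a = n , st (a ∘ toℕ)

blocks : List ℕ → (ℕ → ℕ) → 𝔖Sym
blocks cs a = blockProduct cs (a ∘ toℕ)

-- An instance of `product-𝟙`, once the entries of each piece are indexed through the whole range
-- `Fin (c + sum cs)`.
blocks-∷ : ∀ c cs a b → lin (productCoeff b (prefix c a)) (blocks cs (a ∘ (c +_))) ≡ coeff𝔖 (blocks (c ∷ cs) a) b
blocks-∷ c cs a b = begin
  lin (productCoeff b (prefix c a)) (blocks cs (a ∘ (c +_)))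
    ≡⟨ lin-ext (λ y → productCoeff-cong b {y = y}
         (same (st-≗ {b = head} λ i → cong a (sym (Fin.toℕ-↑ˡ i (sum cs))))) (same λ _ → refl)) (blocks cs (a ∘ (c +_))) ⟩
  lin (productCoeff b (c , st head)) (blocks cs (a ∘ (c +_)))
    ≡⟨ lin-cong 𝔖-decSetoid (λ {y} {y′} → productCoeff-congʳ b (c , st head) {y} {y′})
         (blocks cs (a ∘ (c +_))) (blockProduct cs rest)
         (blockProduct-≗ cs (λ i → cong a (sym (Fin.toℕ-↑ʳ c i)))) ⟩
  lin (productCoeff b (c , st head)) (blockProduct cs rest)
    ≡⟨ product-𝟙 c cs (st head) (stBlocks cs rest) b ⟩
  coeff𝔖 (blocks (c ∷ cs) a) b ∎
  where
  open ≡-Reasoning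
  head : Fin c → ℕ
  head i = a (toℕ (i ↑ˡ sum cs))
  rest : Fin (sum cs) → ℕ
  rest i = a (toℕ (c ↑ʳ i))

-- Signed sums over subsets

sumOver-allFin-suc : ∀ n (f : Fin (suc n) → ℚ) → sumOver (allFin (suc n)) f ≡ f zero ℚ.+ sumOver (allFin n) (f ∘ suc)
sumOver-allFin-suc n f = cong (f zero ℚ.+_)
  (trans (cong (λ is → sumOver is f) (sym (map-tabulate id suc))) (sumOver-map suc (allFin n) f))

sgn : Subset m → ℚ
sgn J = sign (2 ∣? ∣ J ∣)

sign-suc : ∀ k → sign (2 ∣? suc k) ≡ ℚ.- sign (2 ∣? k)
sign-suc zero    = refl
sign-suc (suc k) = trans
  (sign-⇔ (mk⇔ (λ d → ∣m+n∣m⇒∣n d ∣-refl) (∣m∣n⇒∣m+n ∣-refl)) (2 ∣? suc (suc k)) (2 ∣? k))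
  (trans (sym (⁻¹-involutive (sign (2 ∣? k)))) (cong ℚ.-_ (sym (sign-suc k))))

module _ (h : List ℕ → ℚ) where

  -- The contribution of a first block of length c followed by q further letters, with S of those
  -- letters expanded. For q = 0 the coefficient is 1 because S(1) = 1, whereas `sgn` of the empty
  -- subset is -1.
  tailSum : ℕ → ℕ → ℚ
  tailSum c zero    = h (c ∷ [])
  tailSum c (suc q) = sumOver (subsets q) λ J → sgn J ℚ.* h (c ∷ gaps 1 J)

  -- The subsets are grouped according to their least element.
  sumOver-subsets : ∀ m c → sumOver (subsets m) (λ J → sgn J ℚ.* h (gaps c J)) ≡
                    ℚ.- sumOver (allFin (suc m)) (λ i → tailSum (c + toℕ i) (m ∸ toℕ i))
  sumOver-subsets zero c rewrite ℕ.+-identityʳ c =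
    trans (ℚ.+-identityʳ _) (trans (sym (ℚ.neg-distribˡ-* 1ℚ (h (c ∷ []))))
    (cong ℚ.-_ (trans (ℚ.*-identityˡ (h (c ∷ []))) (sym (ℚ.+-identityʳ (h (c ∷ [])))))))
  sumOver-subsets (suc m) c = begin
    sumOver (subsets (suc m)) (λ J → sgn J ℚ.* h (gaps c J))
      ≡⟨ sumOver-++ (map (outside ∷_) (subsets m)) _ _ ⟩
    sumOver (map (outside ∷_) (subsets m)) (λ J → sgn J ℚ.* h (gaps c J)) ℚ.+
    sumOver (map (inside ∷_) (subsets m)) (λ J → sgn J ℚ.* h (gaps c J))
      ≡⟨ cong₂ ℚ._+_ (sumOver-map (outside ∷_) (subsets m) _) (sumOver-map (inside ∷_) (subsets m) _) ⟩
    sumOver (subsets m) (λ J → sgn J ℚ.* h (gaps (suc c) J)) ℚ.+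
    sumOver (subsets m) (λ J → sgn (inside ∷ J) ℚ.* h (c ∷ gaps 1 J))
      ≡⟨ cong₂ ℚ._+_ (sumOver-subsets m (suc c)) (trans (sumOver-cong flipSign (subsets m)) (sumOver-neg (subsets m) _)) ⟩
    ℚ.- sumOver (allFin (suc m)) (λ i → tailSum (suc c + toℕ i) (m ∸ toℕ i)) ℚ.+ ℚ.- tailSum c (suc m)
      ≡⟨ ℚ.+-comm (ℚ.- sumOver (allFin (suc m)) (λ i → tailSum (suc c + toℕ i) (m ∸ toℕ i))) _ ⟩
    ℚ.- tailSum c (suc m) ℚ.+ ℚ.- sumOver (allFin (suc m)) (λ i → tailSum (suc c + toℕ i) (m ∸ toℕ i))
      ≡⟨ ℚ.neg-distrib-+ (tailSum c (suc m)) _ ⟨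
    ℚ.- (tailSum c (suc m) ℚ.+ sumOver (allFin (suc m)) (λ i → tailSum (suc c + toℕ i) (m ∸ toℕ i)))
      ≡⟨ cong ℚ.-_ (cong₂ ℚ._+_ (cong (λ k → tailSum k (suc m)) (sym (ℕ.+-identityʳ c)))
           (sumOver-cong (λ i → cong (λ k → tailSum k (m ∸ toℕ i)) (sym (ℕ.+-suc c (toℕ i)))) (allFin (suc m)))) ⟩
    ℚ.- (tailSum (c + 0) (suc m) ℚ.+ sumOver (allFin (suc m)) (λ i → tailSum (c + suc (toℕ i)) (m ∸ toℕ i)))
      ≡⟨ cong ℚ.-_ (sumOver-allFin-suc (suc m) (λ i → tailSum (c + toℕ i) (suc m ∸ toℕ i))) ⟨
    ℚ.- sumOver (allFin (suc (suc m))) (λ i → tailSum (c + toℕ i) (suc m ∸ toℕ i)) ∎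
    where
    open ≡-Reasoning
    flipSign : ∀ (J : Subset m) → sgn (inside ∷ J) ℚ.* h (c ∷ gaps 1 J) ≡ ℚ.- (sgn J ℚ.* h (c ∷ gaps 1 J))
    flipSign J = trans (cong (ℚ._* h (c ∷ gaps 1 J)) (sign-suc ∣ J ∣)) (sym (ℚ.neg-distribˡ-* (sgn J) _))

-- The antipode

-- Only the relative order matters, so standardizing before restricting changes nothing. This is
-- needed because the coproduct cuts a word that is already standardized.
st-restrict : ∀ {k} {f : Fin n → ℕ} → Injective _≡_ _≡_ f → (ι : Fin k → Fin n) {g : Fin k → ℕ} →
              (∀ i → f (ι i) ≡ g i) → st (oneLine (st f) ∘ ι) Perm.≈ st g
st-restrict {f = f} inj ι {g} eq = st-cong λ i j → mk⇔
  (λ lt → subst₂ _<_ (eq i) (eq j) (Equivalence.from (st-order f inj (ι i) (ι j)) lt))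
  (λ lt → Equivalence.to (st-order f inj (ι i) (ι j)) (subst₂ _<_ (sym (eq i)) (sym (eq j)) lt))

coeff-signedSum : ∀ (x : Subset m → 𝔖Sym) b → coeff𝔖 (∑ (subsets m) (λ J → sgn J • x J)) b ≡
                  sumOver (subsets m) (λ J → sgn J ℚ.* coeff𝔖 (x J) b)
coeff-signedSum {m} x b = trans (coeff-lin 𝔖-decSetoid (∑ (subsets m) (λ J → sgn J • x J)) b)
  (trans (lin-∑ _ (subsets m) (λ J → sgn J • x J)) (sumOver-cong (λ J →
    trans (lin-• _ (sgn J) (x J)) (cong (sgn J ℚ.*_) (sym (coeff-lin 𝔖-decSetoid (x J) b)))) (subsets m)))

module _ (S : 𝔖Sym → 𝔖Sym) (antipode : IsAntipode S) where
  open IsAntipode antipode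

  S-cong : ∀ {x y} → x ≈𝔖 y → S (basis x) ≈ S (basis y)
  S-cong {x} {y} x≈y = IsModuleHomomorphism.⟦⟧-cong isLinear {basis x} {basis y} (basis-cong 𝔖-decSetoid x≈y)

  -- The coefficient at b of ℱ_x · S(ℱ_y).
  productCoeffS : 𝔖 → 𝔖 → 𝔖 → ℚ
  productCoeffS b x y = lin (productCoeff b x) (S (basis y))

  productCoeffS-cong : ∀ b {x x′ y y′} → x ≈𝔖 x′ → y ≈𝔖 y′ → productCoeffS b x y ≡ productCoeffS b x′ y′
  productCoeffS-cong b {x} {x′} {y} {y′} x≈ y≈ = trans
    (lin-ext (λ z → productCoeff-cong b {x} {x′} {z} {z} x≈ (same λ _ → refl)) (S (basis y)))
    (lin-cong 𝔖-decSetoid (λ {z} {z′} → productCoeff-congʳ b x′ {z} {z′})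
      (S (basis y)) (S (basis y′)) (S-cong y≈))

  productCoeffS-identityˡ : ∀ b y → productCoeffS b (0 , Perm.id) y ≡ coeff𝔖 (S (basis y)) b
  productCoeffS-identityˡ b y =
    trans (lin-ext (productCoeff-identityˡ b) (S (basis y))) (sym (coeff-lin 𝔖-decSetoid (S (basis y)) b))

  pairing : 𝔖 → 𝔖 × 𝔖 → ℚ
  pairing b (y , z) = productCoeffS b y z

  coeff-convolution : ∀ x b → coeff𝔖 (μ ((id ⊗ S) (Δ (basis x)))) b ≡ lin (pairing b) (coproduct x)
  coeff-convolution x b = begin
    coeff𝔖 (μ ((id ⊗ S) (Δ (basis x)))) b
      ≡⟨ coeff-lin 𝔖-decSetoid (μ ((id ⊗ S) (Δ (basis x)))) b ⟩
    lin (λ c → ind (c ≟𝔖 b)) (μ ((id ⊗ S) (Δ (basis x))))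
      ≡⟨ lin-extend _ product ((id ⊗ S) (Δ (basis x))) ⟩
    lin (λ yz → lin (λ c → ind (c ≟𝔖 b)) (product yz)) ((id ⊗ S) (Δ (basis x)))
      ≡⟨ lin-ext (λ yz → coeff-lin 𝔖-decSetoid (product yz) b) ((id ⊗ S) (Δ (basis x))) ⟨
    lin (λ yz → coeff𝔖 (product yz) b) ((id ⊗ S) (Δ (basis x)))
      ≡⟨ lin-extend _ (λ (y , z) → basis y ⊠ S (basis z)) (Δ (basis x)) ⟩
    lin (λ (y , z) → lin (λ yz → coeff𝔖 (product yz) b) (basis y ⊠ S (basis z))) (Δ (basis x))
      ≡⟨ lin-ext (λ (y , z) → lin-basis-⊠ (λ yz → coeff𝔖 (product yz) b) y (S (basis z))) (Δ (basis x)) ⟩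
    lin (pairing b) (Δ (basis x))
      ≡⟨ lin-extend (pairing b) coproduct (basis x) ⟩
    lin (λ x → lin (pairing b) (coproduct x)) (basis x)
      ≡⟨ lin-basis (λ x → lin (pairing b) (coproduct x)) x ⟩
    lin (pairing b) (coproduct x) ∎
    where open ≡-Reasoning

  -- The i-th summand of the coproduct cuts the word after i letters, and `st-restrict` lets both
  -- pieces be read off from the sequence a itself.
  convolution-prefix : ∀ n {a} → Injective _≡_ _≡_ a → ∀ b →
    sumOver (allFin (suc n)) (λ i → productCoeffS b (prefix (toℕ i) a) (prefix (n ∸ toℕ i) (a ∘ (toℕ i +_))))
      ≡ coeff𝔖 (η (ε (basis (prefix n a)))) b
  convolution-prefix n {a} inj b = sym (begin
    coeff𝔖 (η (ε (basis (prefix n a)))) b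
      ≡⟨ inverseʳ (basis (prefix n a)) b ⟨
    coeff𝔖 (μ ((id ⊗ S) (Δ (basis (prefix n a))))) b
      ≡⟨ coeff-convolution (prefix n a) b ⟩
    lin (pairing b) (coproduct (prefix n a))
      ≡⟨ lin-∑ (pairing b) (allFin (suc n)) (λ i → ℱ (left i) ⊠ ℱ (right i)) ⟩
    sumOver (allFin (suc n)) (λ i → lin (pairing b) (ℱ (left i) ⊠ ℱ (right i)))
      ≡⟨ sumOver-cong term (allFin (suc n)) ⟩
    sumOver (allFin (suc n)) (λ i → productCoeffS b (prefix (toℕ i) a) (prefix (n ∸ toℕ i) (a ∘ (toℕ i +_)))) ∎)
    where
    open ≡-Reasoning
    split : ∀ (i : Fin (suc n)) → toℕ i + (n ∸ toℕ i) ≡ n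
    split i = ℕ.m+[n∸m]≡n {toℕ i} {n} (Fin.toℕ≤pred[n] i)

    left : ∀ (i : Fin (suc n)) → Permutation′ (toℕ i)
    left i = st (oneLine (st {n} (a ∘ toℕ)) ∘ cast (split i) ∘ (_↑ˡ (n ∸ toℕ i)))

    right : ∀ (i : Fin (suc n)) → Permutation′ (n ∸ toℕ i)
    right i = st (oneLine (st {n} (a ∘ toℕ)) ∘ cast (split i) ∘ (toℕ i ↑ʳ_))

    term : ∀ i → lin (pairing b) (ℱ (left i) ⊠ ℱ (right i)) ≡
                 productCoeffS b (prefix (toℕ i) a) (prefix (n ∸ toℕ i) (a ∘ (toℕ i +_)))
    term i = trans (lin-basis-⊠ (pairing b) (toℕ i , left i) (ℱ (right i)))
      (trans (lin-basis (productCoeffS b (toℕ i , left i)) (n ∸ toℕ i , right i))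
      (productCoeffS-cong b
        {toℕ i , left i} {prefix (toℕ i) a} {n ∸ toℕ i , right i} {prefix (n ∸ toℕ i) (a ∘ (toℕ i +_))}
        (same (st-restrict (Fin.toℕ-injective ∘ inj) (cast (split i) ∘ (_↑ˡ (n ∸ toℕ i))) λ k →
          cong a (trans (Fin.toℕ-cast (split i) _) (Fin.toℕ-↑ˡ k (n ∸ toℕ i)))))
        (same (st-restrict (Fin.toℕ-injective ∘ inj) (cast (split i) ∘ (toℕ i ↑ʳ_)) λ k →
          cong a (trans (Fin.toℕ-cast (split i) _) (Fin.toℕ-↑ʳ (toℕ i) k))))))

  -- In degree 0 the convolution has a single summand, and η(ε(ℱ)) of the empty permutation computes
  -- to the same coefficients as the empty block product.
  S-prefix-zero : ∀ {a} → Injective _≡_ _≡_ a → S (basis (prefix 0 a)) ≈ blocks [] a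
  S-prefix-zero {a} inj b = trans (sym (productCoeffS-identityˡ b (prefix 0 a)))
    (trans (sym (ℚ.+-identityʳ _)) (convolution-prefix 0 inj b))

  S-prefix-suc : ∀ m {a} → Injective _≡_ _≡_ a → ∀ b →
    coeff𝔖 (S (basis (prefix (suc m) a))) b ≡
    ℚ.- sumOver (allFin (suc m)) (λ i → productCoeffS b (prefix (suc (toℕ i)) a) (prefix (m ∸ toℕ i) (a ∘ (suc (toℕ i) +_))))
  S-prefix-suc m {a} inj b = inverseˡ-unique _ _
    (trans (cong (ℚ._+ sumOver (allFin (suc m)) (terms ∘ suc)) (sym (productCoeffS-identityˡ b (prefix (suc m) a))))
    (trans (sym (sumOver-allFin-suc (suc m) terms))
    (trans (convolution-prefix (suc m) inj b)
    -- The counit vanishes in positive degree by computation, which leaves `η 0ℚ`.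
    (trans (coeff-lin 𝔖-decSetoid (η 0ℚ) b)
    (trans (lin-• (λ c → ind (c ≟𝔖 b)) 0ℚ (ℱ {0} Perm.id)) (ℚ.*-zeroˡ (lin (λ c → ind (c ≟𝔖 b)) (ℱ {0} Perm.id))))))))
    where
    terms : Fin (suc (suc m)) → ℚ
    terms i = productCoeffS b (prefix (toℕ i) a) (prefix (suc m ∸ toℕ i) (a ∘ (toℕ i +_)))

  -- The sequence is quantified inside, so that the hypothesis for a shorter length applies to the
  -- shifted sequence `a ∘ (p +_)`, which is again injective.
  S-Prefix : ℕ → Set
  S-Prefix m = ∀ a → Injective _≡_ _≡_ a →
               S (basis (prefix (suc m) a)) ≈ ∑ (subsets m) (λ J → sgn J • blocks (gaps 1 J) a)

  productCoeffS-prefix : ∀ {m} → (∀ {k} → k < m → S-Prefix k) → ∀ a → Injective _≡_ _≡_ a → ∀ b p q → q ≤ m →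
    productCoeffS b (prefix p a) (prefix q (a ∘ (p +_))) ≡ tailSum (λ cs → coeff𝔖 (blocks cs a) b) p q
  productCoeffS-prefix rec a inj b p zero _ = trans
    (lin-cong 𝔖-decSetoid (λ {y} {z} → productCoeff-congʳ b (prefix p a) {y} {z})
      (S (basis (prefix 0 (a ∘ (p +_))))) (blocks [] (a ∘ (p +_))) (S-prefix-zero (ℕ.+-cancelˡ-≡ p _ _ ∘ inj)))
    (blocks-∷ p [] a b)
  -- `S-Prefix q` concerns words of length `suc q`, so `suc q ≤ m` is precisely the bound q < m that
  -- the induction asks for.
  productCoeffS-prefix rec a inj b p (suc q) q<m = trans
    (lin-cong 𝔖-decSetoid (λ {y} {z} → productCoeff-congʳ b (prefix p a) {y} {z})
      (S (basis (prefix (suc q) (a ∘ (p +_))))) (∑ (subsets q) (λ J → sgn J • blocks (gaps 1 J) (a ∘ (p +_))))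
      (rec q<m (a ∘ (p +_)) (ℕ.+-cancelˡ-≡ p _ _ ∘ inj)))
    (trans (lin-∑ _ (subsets q) (λ J → sgn J • blocks (gaps 1 J) (a ∘ (p +_))))
    (sumOver-cong (λ J → trans (lin-• _ (sgn J) (blocks (gaps 1 J) (a ∘ (p +_))))
      (cong (sgn J ℚ.*_) (blocks-∷ p (gaps 1 J) a b))) (subsets q)))

  S-prefix : ∀ m → S-Prefix m
  S-prefix = <-rec S-Prefix λ m rec a inj b →
    trans (S-prefix-suc m inj b)
    (trans (cong ℚ.-_ (sumOver-cong
      (λ i → productCoeffS-prefix rec a inj b (suc (toℕ i)) (m ∸ toℕ i) (ℕ.m∸n≤m m (toℕ i))) (allFin (suc m))))
    -- The block length starts at 1: the summand with empty first block is the one that was solved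
    -- for.
    (trans (sym (sumOver-subsets (λ cs → coeff𝔖 (blocks cs a) b) m 1))
           (sym (coeff-signedSum {m} (λ J → blocks (gaps 1 J) a) b))))

-- Outside its domain f is extended by the identity, so that the one-line
-- notation of a permutation becomes an injective sequence.
total : (Fin n → ℕ) → ℕ → ℕ
total {n} f k with k ℕ.<? n
... | yes k<n = f (fromℕ< k<n)
... | no  _   = k

total-toℕ : ∀ (f : Fin n → ℕ) i → total f (toℕ i) ≡ f i
total-toℕ {n} f i with toℕ i ℕ.<? n
... | yes i<n = cong f (Fin.fromℕ<-toℕ i i<n)
... | no  i≮n = contradiction (Fin.toℕ<n i) i≮n

total-oneLine-injective : ∀ (v : Permutation′ n) → Injective _≡_ _≡_ (total (oneLine v))
total-oneLine-injective {n} v {k} {l} eq with k ℕ.<? n | l ℕ.<? n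
... | yes k<n | yes l<n = Fin.fromℕ<-injective k l k<n l<n (⟨$⟩ʳ-injective v (Fin.toℕ-injective eq))
... | yes k<n | no  l≮n = contradiction (subst (_< n) eq (Fin.toℕ<n (v ⟨$⟩ʳ fromℕ< k<n))) l≮n
... | no  k≮n | yes l<n = contradiction (subst (_< n) (sym eq) (Fin.toℕ<n (v ⟨$⟩ʳ fromℕ< l<n))) k≮n
... | no  _   | no  _   = eq

-- Descents

-- Here c counts ascents, so the run has c + 1 values.
Ascending : ℕ → (ℕ → ℕ) → Set
Ascending c F = ∀ i → i < c → F i < F (suc i)

strictMono⇒ascending : ∀ {c F} {f : Fin (suc c) → ℕ} → (∀ i → f i ≡ F (toℕ i)) → StrictMono f → Ascending c F
strictMono⇒ascending {c} {F} {f} eq mono i i<c = subst₂ _<_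
  (trans (eq _) (cong F (Fin.toℕ-fromℕ< i<1+c))) (trans (eq _) (cong F (Fin.toℕ-fromℕ< (s≤s i<c))))
  (mono (fromℕ< i<1+c) (fromℕ< (s≤s i<c))
    (subst₂ _<_ (sym (Fin.toℕ-fromℕ< i<1+c)) (sym (Fin.toℕ-fromℕ< (s≤s i<c))) (ℕ.n<1+n i)))
  where i<1+c = ℕ.m<n⇒m<1+n i<c

ascending⇒strictMono : ∀ {c F} {f : Fin (suc c) → ℕ} → (∀ i → f i ≡ F (toℕ i)) → Ascending c F → StrictMono f
ascending⇒strictMono {c} {F} {f} eq asc i j i<j =
  subst₂ _<_ (sym (eq i)) (sym (eq j)) (go (toℕ j) i<j (Fin.toℕ<n j))
  where
  go : ∀ {k} l → k < l → l < suc c → F k < F l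
  go (suc l) (s≤s k≤l) (s≤s l<c) with ℕ.m≤n⇒m<n∨m≡n k≤l
  ... | inj₁ k<l  = ℕ.<-trans (go l k<l (ℕ.m<n⇒m<1+n l<c)) (asc l l<c)
  ... | inj₂ refl = asc l l<c

-- The index i of J separates the 0-based positions c + i and c + i + 1, because positions 0 to c
-- already belong to the current block.
AscendingOutside : ℕ → Subset m → (ℕ → ℕ) → Set
AscendingOutside {m} c J F = ∀ (i : Fin m) → i ∉ J → F (c + toℕ i) < F (suc (c + toℕ i))

-- Generalized to a block in progress holding c + 1 positions: `inside` closes it and restarts at 0
-- with F shifted by c + 1, while `outside` lengthens it by one.
incBlocks⇒ascending : ∀ c (J : Subset m) {F f} → (∀ i → f i ≡ F (toℕ i)) →
                      IncBlocks (gaps (suc c) J) f → Ascending c F × AscendingOutside c J F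
incBlocks⇒ascending c [] {F} eq (mono , _) =
  strictMono⇒ascending {F = F} (λ i → trans (eq _) (cong F (Fin.toℕ-↑ˡ i 0))) mono , λ ()
incBlocks⇒ascending c (inside ∷ J) {F} eq (mono , inc)
  with _ , out ← incBlocks⇒ascending 0 J {F ∘ (suc c +_)} (λ i → trans (eq _) (cong F (Fin.toℕ-↑ʳ (suc c) i))) inc =
  strictMono⇒ascending {F = F} (λ i → trans (eq _) (cong F (Fin.toℕ-↑ˡ i _))) mono ,
  λ { zero    z∉ → contradiction here z∉
    ; (suc i) i∉ → subst₂ (λ k l → F k < F l) (sym (ℕ.+-suc c (toℕ i)))
        (cong suc (trans (ℕ.+-suc c (toℕ i)) (sym (ℕ.+-suc c (toℕ i))))) (out i (i∉ ∘ there)) }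
incBlocks⇒ascending c (outside ∷ J) {F} eq inc
  with asc , out ← incBlocks⇒ascending (suc c) J {F} eq inc =
  (λ i i<c → asc i (ℕ.m<n⇒m<1+n i<c)) ,
  λ { zero    _  → subst (λ k → F k < F (suc k)) (sym (ℕ.+-identityʳ c)) (asc c (ℕ.n<1+n c))
    ; (suc i) i∉ → subst (λ k → F k < F (suc k)) (sym (ℕ.+-suc c (toℕ i))) (out i (i∉ ∘ there)) }

ascending⇒incBlocks : ∀ c (J : Subset m) {F f} → (∀ i → f i ≡ F (toℕ i)) →
                      Ascending c F → AscendingOutside c J F → IncBlocks (gaps (suc c) J) f
ascending⇒incBlocks c [] {F} eq asc _ =
  ascending⇒strictMono {F = F} (λ i → trans (eq _) (cong F (Fin.toℕ-↑ˡ i 0))) asc , tt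
ascending⇒incBlocks c (inside ∷ J) {F} eq asc out =
  ascending⇒strictMono {F = F} (λ i → trans (eq _) (cong F (Fin.toℕ-↑ˡ i _))) asc ,
  ascending⇒incBlocks 0 J {F ∘ (suc c +_)} (λ i → trans (eq _) (cong F (Fin.toℕ-↑ʳ (suc c) i))) (λ _ ())
    λ i i∉ → subst₂ (λ k l → F k < F l) (ℕ.+-suc c (toℕ i)) refl (out (suc i) (i∉ ∘ drop-there))
ascending⇒incBlocks c (outside ∷ J) {F} eq asc out =
  ascending⇒incBlocks (suc c) J {F} eq asc′
    λ i i∉ → subst (λ k → F k < F (suc k)) (ℕ.+-suc c (toℕ i)) (out (suc i) (i∉ ∘ drop-there))
  where
  asc′ : Ascending (suc c) F
  asc′ i (s≤s i≤c) with ℕ.m≤n⇒m<n∨m≡n i≤c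
  ... | inj₁ i<c  = asc i i<c
  -- The new last ascent of the run is at the index just read, which lies outside J.
  ... | inj₂ refl = subst (λ k → F k < F (suc k)) (ℕ.+-identityʳ i) (out zero λ ())

module _ (x : Permutation′ (suc m)) where

  private
    descent? : ∀ i → Dec (x ⟨$⟩ʳ suc i Fin.< x ⟨$⟩ʳ inject₁ i)
    descent? i = x ⟨$⟩ʳ suc i Fin.<? x ⟨$⟩ʳ inject₁ i

    F : ℕ → ℕ
    F = total (oneLine x)

    F-inject₁ : ∀ (i : Fin m) → F (toℕ i) ≡ oneLine x (inject₁ i)
    F-inject₁ i = trans (cong F (sym (Fin.toℕ-inject₁ i))) (total-toℕ (oneLine x) (inject₁ i))

    F-suc : ∀ (i : Fin m) → F (suc (toℕ i)) ≡ oneLine x (suc i)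
    F-suc i = total-toℕ (oneLine x) (suc i)

    eq : ∀ {k} .(e : k ≡ suc m) i → oneLine x (cast e i) ≡ F (toℕ i)
    eq e i = trans (sym (total-toℕ (oneLine x) (cast e i))) (cong F (Fin.toℕ-cast e i))

  ∈-Des⁺ : ∀ {i} → x ⟨$⟩ʳ suc i Fin.< x ⟨$⟩ʳ inject₁ i → i ∈ Des x
  ∈-Des⁺ {i} lt = Vec.lookup⇒[]= i _ (trans (Vec.lookup∘tabulate _ i) (dec-true (descent? i) lt))

  ∈-Des⁻ : ∀ {i} → i ∈ Des x → x ⟨$⟩ʳ suc i Fin.< x ⟨$⟩ʳ inject₁ i
  ∈-Des⁻ {i} i∈ with descent? i in eq
  ... | yes lt = lt
  ... | no  _  = contradiction
    (trans (sym (Vec.[]=⇒lookup i∈)) (trans (Vec.lookup∘tabulate _ i) (cong does eq))) λ ()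

  Des⊆⇔incBlocks : ∀ (J : Subset m) → Des x ⊆ J ⇔ IncBlocks (gaps 1 J) (oneLine x ∘ cast (sum-gaps 1 J))
  Des⊆⇔incBlocks J = mk⇔
    (λ Des⊆ → ascending⇒incBlocks 0 J {F} (eq (sum-gaps 1 J)) (λ _ ()) λ i i∉ →
      subst₂ _<_ (sym (F-inject₁ i)) (sym (F-suc i))
        -- The absence of a descent gives only ≤; injectivity of the permutation makes it strict.
        (ℕ.≤∧≢⇒< (ℕ.≮⇒≥ (λ lt → i∉ (Des⊆ (∈-Des⁺ {i} lt)))) (i≢1+i i ∘ ⟨$⟩ʳ-injective x ∘ Fin.toℕ-injective)))
    (λ inc {i} i∈ → from inc i i∈ (i ∈? J))
    where
    i≢1+i : ∀ (i : Fin m) → inject₁ i ≢ suc i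
    i≢1+i i eq = ℕ.<-irrefl (trans (sym (Fin.toℕ-inject₁ i)) (cong toℕ eq)) (ℕ.n<1+n (toℕ i))

    from : IncBlocks (gaps 1 J) (oneLine x ∘ cast (sum-gaps 1 J)) → ∀ i → i ∈ Des x → Dec (i ∈ J) → i ∈ J
    from inc i i∈ (yes i∈J) = i∈J
    from inc i i∈ (no  i∉J) = contradiction (∈-Des⁻ i∈) (ℕ.<-asym
      (subst₂ _<_ (F-inject₁ i) (F-suc i) (proj₂ (incBlocks⇒ascending 0 J {F} (eq (sum-gaps 1 J)) inc) i i∉J)))

-- Identification of the coefficients with λ(v,w).

coeff-blockProduct-cast : ∀ cs (eq : sum cs ≡ n) f w →
  coeff𝔖 (blockProduct cs f) (n , w) ≡
  ind (incBlocks? cs (oneLine (flip w · subst Permutation′ eq (stBlocks cs f)) ∘ cast eq))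
-- The length n is a variable in the statement so that the equation can be matched with `refl`,
-- which `sum-gaps 1 J` itself does not permit.
coeff-blockProduct-cast cs refl f w = trans (coeff-blockProduct cs f w)
  (ind-⇔ (mk⇔ (incBlocks-≗ cs (sym ∘ uncast)) (incBlocks-≗ cs uncast)) (incFrom? cs (stBlocks cs f) w) (incBlocks? cs _))
  where
  uncast : ∀ i → oneLine (flip w · stBlocks cs f) (cast refl i) ≡ oneLine (flip w · stBlocks cs f) i
  uncast i = cong (oneLine (flip w · stBlocks cs f)) (Fin.cast-is-id refl i)

coeff-blocks : ∀ (v w : Permutation′ (suc m)) (J : Subset m) →
  coeff𝔖 (blocks (gaps 1 J) (total (oneLine v))) (suc m , w) ≡ ind (Des (flip w · v ↓ J) ⊆? J)
coeff-blocks {m} v w J = begin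
  coeff𝔖 (blocks (gaps 1 J) (total (oneLine v))) (suc m , w)
    ≡⟨ blockProduct-≗ (gaps 1 J) uncast (suc m , w) ⟩
  coeff𝔖 (blockProduct (gaps 1 J) (oneLine v ∘ cast e)) (suc m , w)
    ≡⟨ coeff-blockProduct-cast (gaps 1 J) e (oneLine v ∘ cast e) w ⟩
  ind (incBlocks? (gaps 1 J) (oneLine (flip w · v ↓ J) ∘ cast e))
    ≡⟨ ind-⇔ (Des⊆⇔incBlocks (flip w · v ↓ J) J) (Des (flip w · v ↓ J) ⊆? J) (incBlocks? (gaps 1 J) _) ⟨
  ind (Des (flip w · v ↓ J) ⊆? J) ∎
  where
  open ≡-Reasoning
  e = sum-gaps 1 J
  uncast : ∀ i → total (oneLine v) (toℕ i) ≡ oneLine v (cast e i)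
  uncast i = trans (cong (total (oneLine v)) (sym (Fin.toℕ-cast e i))) (total-toℕ (oneLine v) (cast e i))

antipodeCoeff-/1 : ∀ (v w : Permutation′ (suc m)) →
  antipodeCoeff v w / 1 ≡ coeff𝔖 (∑ (subsets m) (λ J → sgn J • blocks (gaps 1 J) (total (oneLine v)))) (suc m , w)
antipodeCoeff-/1 {m} v w = trans
  (odd-even-count (λ J → Des (flip w · v ↓ J) ⊆? J) (λ J → 2 ∣? ∣ J ∣) (subsets m))
  (trans (sumOver-cong (λ J → cong (sgn J ℚ.*_) (sym (coeff-blocks v w J))) (subsets m))
  (sym (coeff-signedSum {m} (λ J → blocks (gaps 1 J) (total (oneLine v))) (suc m , w))))

coeff-∑• : ∀ (c : Permutation′ n → ℚ) b →
           coeff𝔖 (∑ (permutations n) (λ w → c w • ℱ w)) b ≡ sumOver (permutations n) (λ w → c w ℚ.* ind ((n , w) ≟𝔖 b))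
coeff-∑• {n} c b = trans (coeff-lin 𝔖-decSetoid (∑ (permutations n) (λ w → c w • ℱ w)) b)
  (trans (lin-∑ δ (permutations n) (λ w → c w • ℱ w))
  (sumOver-cong (λ w → trans (lin-• δ (c w) (ℱ w)) (cong (c w ℚ.*_) (lin-basis δ (n , w)))) (permutations n)))
  where
  δ : 𝔖 → ℚ
  δ a = ind (a ≟𝔖 b)

-- Outside degree n both sides vanish. In degree n the indicator selects one summand, so each
-- coefficient may be taken at b instead of at w.
homogeneous-expansion : ∀ n x → (∀ b → proj₁ b ≢ n → coeff𝔖 x b ≡ 0ℚ) →
                        x ≈ ∑ (permutations n) (λ w → coeff𝔖 x (n , w) • ℱ w)
homogeneous-expansion n x homogeneous b = sym (trans (coeff-∑• (λ w → coeff𝔖 x (n , w)) b)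
  (trans (sumOver-cong move (permutations n))
  (trans (sumOver-* (coeff𝔖 x b) (permutations n) _) (by-degree b (proj₁ b ℕ.≟ n)))))
  where
  move : ∀ w → coeff𝔖 x (n , w) ℚ.* ind ((n , w) ≟𝔖 b) ≡ coeff𝔖 x b ℚ.* ind ((n , w) ≟𝔖 b)
  move w with (n , w) ≟𝔖 b
  ... | yes w≈b = cong (ℚ._* 1ℚ) (coeff-resp 𝔖-decSetoid x w≈b)
  ... | no  _   = trans (ℚ.*-zeroʳ (coeff𝔖 x (n , w))) (sym (ℚ.*-zeroʳ (coeff𝔖 x b)))

  by-degree : ∀ b → Dec (proj₁ b ≡ n) →
              coeff𝔖 x b ℚ.* sumOver (permutations n) (λ w → ind ((n , w) ≟𝔖 b)) ≡ coeff𝔖 x b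
  by-degree b (no b≢n) = 
    trans (cong (ℚ._* count) (homogeneous b b≢n)) (trans (ℚ.*-zeroˡ count) (sym (homogeneous b b≢n)))
    where count = sumOver (permutations n) λ w → ind ((n , w) ≟𝔖 b)
  by-degree (_ , w₀) (yes refl) = trans (cong (coeff𝔖 x (n , w₀) ℚ.*_)
    (sumOver-permutations (λ w → (n , w) ≟𝔖 (n , w₀)) (yes tt)
      (λ u v u≈ v≈ i → trans (same⁻¹ u≈ i) (sym (same⁻¹ v≈ i)))
      (λ u v u≈v u≈ → same λ i → trans (sym (u≈v i)) (same⁻¹ u≈ i))
      (λ _ _ → tt) (λ _ → w₀ , same λ _ → refl)))
    (ℚ.*-identityʳ (coeff𝔖 x (n , w₀)))

mainTheorem8 : (S : 𝔖Sym → 𝔖Sym) → IsAntipode S →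
    (m : ℕ) (v : Permutation′ (suc m)) →
    S (ℱ v) ≈ ∑ (permutations (suc m)) (λ w → (antipodeCoeff v w / 1) • ℱ w)
mainTheorem8 S antipode m v b = begin
  coeff𝔖 (S (ℱ v)) b
    ≡⟨ S-cong S antipode (same v≈) b ⟩
  coeff𝔖 (S (basis (prefix (suc m) a))) b
    ≡⟨ S-prefix S antipode m a (total-oneLine-injective v) b ⟩
  coeff𝔖 x b
    ≡⟨ homogeneous-expansion (suc m) x homogeneous b ⟩
  coeff𝔖 (∑ (permutations (suc m)) (λ w → coeff𝔖 x (suc m , w) • ℱ w)) b
    ≡⟨ coeff-∑• (λ w → coeff𝔖 x (suc m , w)) b ⟩
  sumOver (permutations (suc m)) (λ w → coeff𝔖 x (suc m , w) ℚ.* ind ((suc m , w) ≟𝔖 b))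
    ≡⟨ sumOver-cong (λ w → cong (ℚ._* ind ((suc m , w) ≟𝔖 b)) (antipodeCoeff-/1 v w)) (permutations (suc m)) ⟨
  sumOver (permutations (suc m)) (λ w → antipodeCoeff v w / 1 ℚ.* ind ((suc m , w) ≟𝔖 b))
    ≡⟨ coeff-∑• (λ w → antipodeCoeff v w / 1) b ⟨
  coeff𝔖 (∑ (permutations (suc m)) (λ w → (antipodeCoeff v w / 1) • ℱ w)) b ∎
  where
  open ≡-Reasoning
  a = total (oneLine v)
  x = ∑ (subsets m) (λ J → sgn J • blocks (gaps 1 J) a)

  -- Brings `ℱ v` into the form that `S-prefix` covers: v is the standardization of its own one-line
  -- word.
  v≈ : v Perm.≈ st (a ∘ toℕ)
  v≈ i = trans (sym (st-oneLine v i)) (st-≗ (λ j → sym (total-toℕ (oneLine v) j)) i)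

  homogeneous : ∀ b → proj₁ b ≢ suc m → coeff𝔖 x b ≡ 0ℚ
  homogeneous b b≢ = trans (coeff-signedSum {m} (λ J → blocks (gaps 1 J) a) b) (sumOver-zero (All.universal (λ J →
    trans (cong (sgn J ℚ.*_) (coeff-blockProduct-degree (gaps 1 J) (a ∘ toℕ) {b} (λ eq → b≢ (trans eq (sum-gaps 1 J)))))
          (ℚ.*-zeroʳ (sgn J))) (subsets m)))
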